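{- Let $K$ be the field of real or complex numbers, and let $T$ be a symmetric tensor of order 3 and size $n$ over $K$. Assume moreover that the span of the slices of $T$ contains an invertible matrix. For any integer $r\ge n$, $\operatorname{srank}(T)\le r$ if and only if there is a symmetric tensor $S$ of order 3 and size $r$ over $K$ with slices $Z_1,\ldots,Z_r$ such that: (i) The span of $Z_1,\ldots,Z_r$ contains an invertible matrix. (ii) For any invertible matrix $Z$ in this span, the matrices $Z^{ -1}Z_i$ ($1\le i\le r$) pairwise commute and are diagonalizable over $K$. (iii) $T$ is a subtensor of $S$ in the sense that $T_{ijk}=S_{ijk}$ for all $1\le i,j,k\le n$.
   Context: A tensor of order 3 and size $n$ over $K$ is an array $T\in K^{n\times n\times n}$; it is symmetric if $T_{ijk}$ is invariant under all permutations of $i,j,k$. The $k$-th slice of a symmetric tensor $T$ of size $n$ is the symmetric $n\times n$ matrix $(T_{ijk})_{i,j}$, for $1\le k\le n$. For $u\in K^n$, $u^{\otimes 3}=u\otimes u\otimes u$ is the tensor with entries $u_iu_ju_k$. The symmetric rank $\operatorname{srank}(T)$ over $K$ is the smallest $r$ such that $T=\sum_{i=1}^r u_i^{\otimes 3}$ with $u_i\in K^n$. Spans are taken over $K$. -}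

module Defs where

open import Algebra.Bundles using (AbelianGroup; CommutativeRing)
open import Algebra.Core using (Op₂)
open import Data.Bool.Base using (if_then_else_)
open import Data.Fin.Base using (Fin; inject≤)
open import Data.Fin.Properties using (_≟_)
open import Data.Nat.Base as ℕ using (ℕ)
open import Data.Product.Base using (_×_; _,_; proj₁; ∃; ∃-syntax)
open import Data.Vec.Functional using (Vector)
open import Level using (Level; _⊔_; suc)
open import Relation.Binary.Core using (Rel)
open import Relation.Binary.Structures using (IsTotalOrder)
open import Relation.Nullary.Decidable.Core using (⌊_⌋)
open import Relation.Nullary.Negation.Core using (¬_)
open import Relation.Unary using (Pred; Satisfiable)

import Algebra.Consequences.Setoid
import Algebra.Construct.DirectProduct as DirectProduct
import Algebra.Definitions
import Algebra.Properties.CommutativeMonoid.Sum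
import Algebra.Properties.Ring
import Algebra.Solver.Ring.NaturalCoefficients.Default

-- The real numbers, characterised (up to unique isomorphism) as the
-- Dedekind-complete totally ordered field.  Least upper bounds are required
-- for arbitrary predicates; since the order is antisymmetric only up to _≈_,
-- a predicate need not respect _≈_ for its supremum to make sense.
record CompleteOrderedField c ℓ₁ ℓ₂ : Set (suc (c ⊔ ℓ₁ ⊔ ℓ₂)) where
  field
    commutativeRing : CommutativeRing c ℓ₁

  open CommutativeRing commutativeRing public

  infix 4 _≤_

  field
    0≉1     : ¬ (0# ≈ 1#)
    inverse : ∀ x → ¬ (x ≈ 0#) → ∃[ y ] x * y ≈ 1#

    _≤_          : Rel Carrier ℓ₂
    isTotalOrder : IsTotalOrder _≈_ _≤_
    +-monoʳ-≤    : ∀ x {y z} → y ≤ z → x + y ≤ x + z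
    *-nonNeg     : ∀ {x y} → 0# ≤ x → 0# ≤ y → 0# ≤ x * y

  UpperBound : ∀ {p} → Pred Carrier p → Pred Carrier (c ⊔ ℓ₂ ⊔ p)
  UpperBound P b = ∀ x → P x → x ≤ b

  field
    supremum : (P : Pred Carrier (c ⊔ ℓ₁ ⊔ ℓ₂)) →
               Satisfiable P → Satisfiable (UpperBound P) →
               ∃[ s ] UpperBound P s × (∀ b → UpperBound P b → s ≤ b)

-- R[i], with the pair (a , b) standing for a + bi.
module Complexification {c ℓ} (R : CommutativeRing c ℓ) where

  open CommutativeRing R
  open Algebra.Solver.Ring.NaturalCoefficients.Default commutativeSemiring
    using (solve; _:=_; _:+_; _:*_)
  open Algebra.Properties.Ring ring using (-0#≈0#; -1*x≈-x)

  private
    module +G = AbelianGroup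
      (DirectProduct.abelianGroup +-abelianGroup +-abelianGroup)

  infixl 7 _*ᶜ_

  _*ᶜ_ : Op₂ (Carrier × Carrier)
  (a , b) *ᶜ (x , y) = a * x - b * y , a * y + b * x

  1ᶜ : Carrier × Carrier
  1ᶜ = 1# , 0#

  private
    open Algebra.Definitions +G._≈_
    module Consequences = Algebra.Consequences.Setoid +G.setoid

    *ᶜ-cong : Congruent₂ _*ᶜ_
    *ᶜ-cong (a , b) (x , y) =
      +-cong (*-cong a x) (-‿cong (*-cong b y)) ,
      +-cong (*-cong a y) (*-cong b x)

    -- The semiring solver handles subtraction with - 1# as a variable.
    sub : ∀ {x x′ y y′} → x ≈ x′ → y ≈ y′ → x - y ≈ x′ + - 1# * y′
    sub x≈x′ y≈y′ = +-cong x≈x′ (trans (-‿cong y≈y′) (sym (-1*x≈-x _)))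

    *ᶜ-assoc : Associative _*ᶜ_
    *ᶜ-assoc (a , b) (x , y) (u , v) =
      trans (sub (*-congʳ (sub refl refl)) refl) (trans
        (solve 7 (λ e a b x y u v →
          (a :* x :+ e :* (b :* y)) :* u :+ e :* ((a :* y :+ b :* x) :* v) :=
          a :* (x :* u :+ e :* (y :* v)) :+ e :* (b :* (x :* v :+ y :* u)))
          refl (- 1#) a b x y u v)
        (sym (sub (*-congˡ (sub refl refl)) refl))) ,
      trans (+-congʳ (*-congʳ (sub refl refl))) (trans
        (solve 7 (λ e a b x y u v →
          (a :* x :+ e :* (b :* y)) :* v :+ (a :* y :+ b :* x) :* u :=
          a :* (x :* v :+ y :* u) :+ b :* (x :* u :+ e :* (y :* v)))
          refl (- 1#) a b x y u v)
        (sym (+-congˡ (*-congˡ (sub refl refl)))))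

    *ᶜ-comm : Commutative _*ᶜ_
    *ᶜ-comm (a , b) (x , y) =
      +-cong (*-comm a x) (-‿cong (*-comm b y)) ,
      trans (+-cong (*-comm a y) (*-comm b x)) (+-comm (y * a) (x * b))

    *ᶜ-identityˡ : LeftIdentity 1ᶜ _*ᶜ_
    *ᶜ-identityˡ (a , b) =
      trans (+-cong (*-identityˡ a) (trans (-‿cong (zeroˡ b)) -0#≈0#))
            (+-identityʳ a) ,
      trans (+-cong (*-identityˡ b) (zeroˡ a)) (+-identityʳ b)

    *ᶜ-distribˡ : _*ᶜ_ DistributesOverˡ +G._∙_
    *ᶜ-distribˡ (a , b) (x , y) (u , v) =
      trans (sub refl refl) (trans
        (solve 7 (λ e a b x y u v →
          a :* (x :+ u) :+ e :* (b :* (y :+ v)) :=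
          (a :* x :+ e :* (b :* y)) :+ (a :* u :+ e :* (b :* v)))
          refl (- 1#) a b x y u v)
        (sym (+-cong (sub refl refl) (sub refl refl)))) ,
      solve 6 (λ a b x y u v →
        a :* (y :+ v) :+ b :* (x :+ u) :=
        (a :* y :+ b :* x) :+ (a :* v :+ b :* u))
        refl a b x y u v

  complexification : CommutativeRing c ℓ
  complexification = record
    { Carrier = Carrier × Carrier
    ; _≈_     = +G._≈_
    ; _+_     = +G._∙_
    ; _*_     = _*ᶜ_
    ; -_      = +G._⁻¹
    ; 0#      = +G.ε
    ; 1#      = 1ᶜ
    ; isCommutativeRing = record
      { isRing = record
        { +-isAbelianGroup = +G.isAbelianGroup
        ; *-cong     = *ᶜ-cong
        ; *-assoc    = *ᶜ-assoc
        ; *-identity = Consequences.comm∧idˡ⇒id *ᶜ-comm *ᶜ-identityˡ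
        ; distrib    =
            Consequences.comm∧distrˡ⇒distr +G.∙-cong *ᶜ-comm *ᶜ-distribˡ
        }
      ; *-comm = *ᶜ-comm
      }
    }

data RealOrComplex : Set where
  real complex : RealOrComplex

scalars : ∀ {c ℓ₁ ℓ₂} →
          CompleteOrderedField c ℓ₁ ℓ₂ → RealOrComplex → CommutativeRing c ℓ₁
scalars ℝ real    = CompleteOrderedField.commutativeRing ℝ
scalars ℝ complex = Complexification.complexification
                      (CompleteOrderedField.commutativeRing ℝ)

IsLeast : ∀ {p} → Pred ℕ p → Pred ℕ p
IsLeast P m = P m × (∀ k → P k → m ℕ.≤ k)

-- Used below only for K = ℝ or ℂ; the definitions need just the ring
-- operations.
module Tensors {c ℓ} (K : CommutativeRing c ℓ) where

  open CommutativeRing K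
  open Algebra.Properties.CommutativeMonoid.Sum +-commutativeMonoid
    using (sum)

  private
    variable
      m n r : ℕ

  Matrix : ℕ → Set c
  Matrix n = Fin n → Fin n → Carrier

  infix  4 _≈ᴹ_
  infixl 7 _*ᴹ_

  _≈ᴹ_ : Rel (Matrix n) ℓ
  A ≈ᴹ B = ∀ i j → A i j ≈ B i j

  _*ᴹ_ : Op₂ (Matrix n)
  (A *ᴹ B) i j = sum (λ k → A i k * B k j)

  diagonal : Vector Carrier n → Matrix n
  diagonal d i j = if ⌊ i ≟ j ⌋ then d i else 0#

  1ᴹ : Matrix n
  1ᴹ = diagonal (λ _ → 1#)

  Invertible : Pred (Matrix n) (c ⊔ ℓ)
  Invertible = Algebra.Definitions.Invertible _≈ᴹ_ 1ᴹ _*ᴹ_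

  inv : (A : Matrix n) → Invertible A → Matrix n
  inv A = proj₁

  Diagonalizable : Pred (Matrix n) (c ⊔ ℓ)
  Diagonalizable {n} A =
    ∃[ P ] ∃[ d ] ∃ λ (P-inv : Invertible P) →
      inv P P-inv *ᴹ A *ᴹ P ≈ᴹ diagonal {n} d

  Commute : Rel (Matrix n) ℓ
  Commute A B = A *ᴹ B ≈ᴹ B *ᴹ A

  Span : Vector (Matrix n) m → Pred (Matrix n) (c ⊔ ℓ)
  Span {m = m} A M =
    ∃ λ (a : Vector Carrier m) → M ≈ᴹ λ i j → sum (λ k → a k * A k i j)

  Tensor : ℕ → Set c
  Tensor n = Fin n → Fin n → Fin n → Carrier

  Symmetric : Pred (Tensor n) ℓ
  Symmetric T = ∀ i j k →
    T i j k ≈ T i k j × T i j k ≈ T j i k × T i j k ≈ T j k i ×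
    T i j k ≈ T k i j × T i j k ≈ T k j i

  slices : Tensor n → Vector (Matrix n) n
  slices T k i j = T i j k

  infix 8 _^⊗3

  _^⊗3 : Vector Carrier n → Tensor n
  (u ^⊗3) i j k = u i * u j * u k

  SumOfCubes : Tensor n → Pred ℕ (c ⊔ ℓ)
  SumOfCubes {n} T r =
    ∃ λ (u : Vector (Vector Carrier n) r) →
      ∀ i j k → T i j k ≈ sum (λ l → (u l ^⊗3) i j k)

  -- srank is given as a relation because the minimum cannot be computed:
  -- SRank T m says srank(T) = m, and SRank≤ T r says srank(T) ≤ r.
  SRank : Tensor n → Pred ℕ (c ⊔ ℓ)
  SRank T = IsLeast (SumOfCubes T)

  SRank≤ : Tensor n → Pred ℕ (c ⊔ ℓ)
  SRank≤ T r = ∃[ m ] SRank T m × m ℕ.≤ r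

  Subtensor : .(n ℕ.≤ r) → Tensor n → Tensor r → Set ℓ
  Subtensor n≤r T S = ∀ i j k →
    T i j k ≈ S (inject≤ i n≤r) (inject≤ j n≤r) (inject≤ k n≤r)

{-# OPTIONS --safe #-}
-- If T is the sum of the cubes of the r rows of an r × n matrix U, nondegeneracy of
-- T makes the columns of U independent.  Extending them to an invertible V, the
-- cubes of the rows of V sum to a tensor S with slices Vᵀ D_k V, D_k diagonal.
-- Any invertible Z in their span is Vᵀ D V, so Z⁻¹ Z_k = V⁻¹ D⁻¹ D_k V.
--
-- Conversely, diagonalize all Z⁻¹ Z_k by one matrix P.  If Z = Σ_k a_k Z_k, then
-- Z⁻¹ Z_k e_j = Z⁻¹ Z_j e_k by symmetry of S, so the Z⁻¹ Z_k are the multiplications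
-- of a commutative algebra with unit a, whose characters are the vectors λ_l of
-- eigenvalues.  Hence S is a linear combination of the λ_l^⊗3, and the
-- coefficients have cube roots in K.  Over ℝ these come from the intermediate
-- value theorem; over ℂ by solving the triple-angle equation over ℝ.
module Submission where

open import Defs
open import Algebra.Bundles using (CommutativeRing; Monoid)
open import Algebra.Bundles.Raw using (RawRing)
open import Algebra.Solver.Ring.AlmostCommutativeRing
  using (_-Raw-AlmostCommutative⟶_; fromCommutativeRing)
open import Axiom.ExcludedMiddle using (ExcludedMiddle)
open import Data.Fin.Base as Fin using (Fin; zero; suc; toℕ; fromℕ<; inject≤)
open import Data.Integer.Base as ℤ using (ℤ; +_; -[1+_]; _⊖_; 0ℤ; 1ℤ)
open import Data.Maybe.Base using (map)
open import Data.Nat.Base as ℕ using (ℕ; zero; suc)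
open import Data.Nat.Induction using (<-rec)
open import Data.Product.Base using (_×_; ∃; ∃-syntax; _,_; proj₁; proj₂)
open import Data.Sign.Base as Sign using (Sign)
open import Data.Sum.Base using (_⊎_; inj₁; inj₂; [_,_]′)
open import Data.Vec.Functional using (Vector; removeAt)
open import Function.Base using (_∘_; case_of_)
open import Function.Bundles using (_⇔_; mk⇔; Equivalence)
open import Level using (_⊔_; Lift; lift; lower)
open import Relation.Binary.Definitions using (Decidable)
open import Relation.Binary.PropositionalEquality.Core as ≡ using (_≡_; _≢_)
open import Relation.Binary.Structures using (IsTotalOrder)
open import Relation.Nullary.Decidable.Core
  using (Dec; yes; no; dec⇒maybe; map′; _×-dec_)
open import Relation.Nullary.Negation.Core using (¬_; contradiction)
open import Relation.Unary using (Pred)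

import Algebra.Properties.AbelianGroup
import Algebra.Properties.Ring
import Algebra.Properties.Semiring.Mult.TCOptimised
import Algebra.Properties.Semiring.Sum
import Algebra.Solver.Monoid
import Algebra.Solver.Ring
import Data.Fin.Properties as Fin
import Data.Integer.Properties as ℤ
import Data.Nat.Properties as ℕ
import Relation.Binary.Reasoning.Setoid

-- Two invertible matrices are needed, the `V` that extends independent columns and the `P` of joint
-- eigenvectors, and one procedure builds both: start from the identity and exchange its columns one
-- at a time. Exchanging column k for w multiplies P on the right by a rank-one perturbation of the
-- identity, whose inverse is explicit, so determinants, dimension and elimination never occur. The
-- perturbation is steered by a functional φ that is 1 at k, 0 before k and nonzero on P⁻¹w. Its
-- values after k are free, and this freedom takes the place of pivoting. For eigenvectors the
-- obstacle is independence from the columns already chosen. Hence they are sought with φ · w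
-- nonzero for a prescribed φ, a condition that survives in at least one spectral projection because
-- the projections sum to 1. The intermediate value theorem is proved from an explicit one-sided
-- slope bound instead of continuity, so that each estimate on a polynomial becomes a ring identity.

private
  variable
    m n r : ℕ

-- The library's ring solver with integer coefficients, so that terms of
-- opposite sign cancel.
module IntegerSolver {c ℓ} (K : CommutativeRing c ℓ) where

  open CommutativeRing K
  open Algebra.Properties.AbelianGroup +-abelianGroup
    using () renaming (ε⁻¹≈ε to -0≈0; ⁻¹-∙-comm to -‿+-comm; ⁻¹-involutive to -‿involutive)
  open Algebra.Properties.Ring ring using (-‿distribˡ-*; -‿distribʳ-*)
  open Algebra.Properties.Semiring.Mult.TCOptimised semiring
    using (1+×; ×-homo-+; ×1-homo-*) renaming (_×_ to _•_)
  open Relation.Binary.Reasoning.Setoid setoid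

  ⟦_⟧ℤ : ℤ → Carrier
  ⟦ + n      ⟧ℤ = n • 1#
  ⟦ -[1+ n ] ⟧ℤ = - (suc n • 1#)

  ⊖-homo : ∀ m n → ⟦ m ⊖ n ⟧ℤ ≈ m • 1# - n • 1#
  ⊖-homo m       zero    = sym (trans (+-congˡ -0≈0) (+-identityʳ _))
  ⊖-homo zero    (suc n) = sym (+-identityˡ _)
  ⊖-homo (suc m) (suc n) = begin
    ⟦ suc m ⊖ suc n ⟧ℤ                     ≡⟨ ≡.cong ⟦_⟧ℤ (ℤ.[1+m]⊖[1+n]≡m⊖n m n) ⟩
    ⟦ m ⊖ n ⟧ℤ                             ≈⟨ ⊖-homo m n ⟩
    m • 1# - n • 1#                        ≈⟨ +-congʳ (+-identityˡ _) ⟨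
    0# + m • 1# - n • 1#                   ≈⟨ +-congʳ (+-congʳ (-‿inverseʳ 1#)) ⟨
    1# - 1# + m • 1# - n • 1#              ≈⟨ +-congʳ (trans (+-assoc _ _ _) (+-congˡ (+-comm _ _))) ⟩
    1# + (m • 1# - 1#) - n • 1#            ≈⟨ +-congʳ (+-assoc _ _ _) ⟨
    1# + m • 1# - 1# - n • 1#              ≈⟨ +-assoc _ _ _ ⟩
    1# + m • 1# + (- 1# - n • 1#)          ≈⟨ +-congˡ (-‿+-comm _ _) ⟩
    1# + m • 1# - (1# + n • 1#)            ≈⟨ +-cong (1+× m 1#) (-‿cong (1+× n 1#)) ⟨
    suc m • 1# - suc n • 1#                ∎

  -◃-homo : ∀ n → ⟦ Sign.- ℤ.◃ n ⟧ℤ ≈ - (n • 1#)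
  -◃-homo zero    = sym -0≈0
  -◃-homo (suc n) = refl

  +-homo : ∀ i j → ⟦ i ℤ.+ j ⟧ℤ ≈ ⟦ i ⟧ℤ + ⟦ j ⟧ℤ
  +-homo (+ m)    (+ n)    = ×-homo-+ 1# m n
  +-homo (+ m)    -[1+ n ] = ⊖-homo m (suc n)
  +-homo -[1+ m ] (+ n)    = trans (⊖-homo n (suc m)) (+-comm _ _)
  +-homo -[1+ m ] -[1+ n ] = begin
    - (suc (suc (m ℕ.+ n)) • 1#)       ≈⟨ -‿cong (1+× (suc m ℕ.+ n) 1#) ⟩
    - (1# + (suc m ℕ.+ n) • 1#)        ≈⟨ -‿cong (+-congˡ (×-homo-+ 1# (suc m) n)) ⟩
    - (1# + (suc m • 1# + n • 1#))     ≈⟨ -‿cong (trans (sym (+-assoc _ _ _))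
                                            (trans (+-congʳ (+-comm _ _)) (+-assoc _ _ _))) ⟩
    - (suc m • 1# + (1# + n • 1#))     ≈⟨ -‿cong (+-congˡ (1+× n 1#)) ⟨
    - (suc m • 1# + suc n • 1#)        ≈⟨ -‿+-comm _ _ ⟨
    - (suc m • 1#) - suc n • 1#        ∎

  *-homo : ∀ i j → ⟦ i ℤ.* j ⟧ℤ ≈ ⟦ i ⟧ℤ * ⟦ j ⟧ℤ
  *-homo (+ m) (+ n) = begin
    ⟦ Sign.+ ℤ.◃ m ℕ.* n ⟧ℤ  ≡⟨ ≡.cong ⟦_⟧ℤ (ℤ.+◃n≡+n (m ℕ.* n)) ⟩
    (m ℕ.* n) • 1#           ≈⟨ ×1-homo-* m n ⟩
    m • 1# * n • 1#          ∎
  *-homo (+ m) -[1+ n ] = begin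
    ⟦ Sign.- ℤ.◃ m ℕ.* suc n ⟧ℤ  ≈⟨ -◃-homo (m ℕ.* suc n) ⟩
    - ((m ℕ.* suc n) • 1#)       ≈⟨ -‿cong (×1-homo-* m (suc n)) ⟩
    - (m • 1# * suc n • 1#)      ≈⟨ -‿distribʳ-* _ _ ⟩
    m • 1# * - (suc n • 1#)      ∎
  *-homo -[1+ m ] (+ n) = begin
    ⟦ Sign.- ℤ.◃ suc m ℕ.* n ⟧ℤ  ≈⟨ -◃-homo (suc m ℕ.* n) ⟩
    - ((suc m ℕ.* n) • 1#)       ≈⟨ -‿cong (×1-homo-* (suc m) n) ⟩
    - (suc m • 1# * n • 1#)      ≈⟨ -‿distribˡ-* _ _ ⟩
    - (suc m • 1#) * n • 1#      ∎
  *-homo -[1+ m ] -[1+ n ] = begin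
    (suc m ℕ.* suc n) • 1#           ≈⟨ ×1-homo-* (suc m) (suc n) ⟩
    suc m • 1# * suc n • 1#          ≈⟨ -‿involutive _ ⟨
    - - (suc m • 1# * suc n • 1#)    ≈⟨ -‿cong (-‿distribʳ-* _ _) ⟩
    - (suc m • 1# * - (suc n • 1#))  ≈⟨ -‿distribˡ-* _ _ ⟩
    - (suc m • 1#) * - (suc n • 1#)  ∎

  -‿homo : ∀ i → ⟦ ℤ.- i ⟧ℤ ≈ - ⟦ i ⟧ℤ
  -‿homo (+ zero)  = sym -0≈0
  -‿homo (+ suc n) = refl
  -‿homo -[1+ n ]  = sym (-‿involutive _)

  ℤ-rawRing : RawRing _ _
  ℤ-rawRing = record
    { Carrier = ℤ ; _≈_ = _≡_
    ; _+_ = ℤ._+_ ; _*_ = ℤ._*_ ; -_ = ℤ.-_ ; 0# = ℤ.0ℤ ; 1# = ℤ.1ℤ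
    }

  homomorphism : ℤ-rawRing -Raw-AlmostCommutative⟶ fromCommutativeRing K
  homomorphism = record
    { ⟦_⟧    = ⟦_⟧ℤ
    ; +-homo = +-homo
    ; *-homo = *-homo
    ; -‿homo = -‿homo
    ; 0-homo = refl
    ; 1-homo = refl
    }

  open Algebra.Solver.Ring ℤ-rawRing (fromCommutativeRing K) homomorphism
    (λ i j → map (λ i≡j → reflexive (≡.cong ⟦_⟧ℤ i≡j)) (dec⇒maybe (i ℤ.≟ j)))
    public
    using (solve; _:=_; _:+_; _:*_; _:-_; :-_; con)

-- Conjugation and congruence identities in a monoid

module Conjugation {c ℓ} (M : Monoid c ℓ) where

  open Monoid M
  open Algebra.Solver.Monoid M using (solve; _⊕_; _⊜_)
  open Relation.Binary.Reasoning.Setoid setoid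

  conj-∙ : ∀ p q a b → q ∙ p ≈ ε → (p ∙ a ∙ q) ∙ (p ∙ b ∙ q) ≈ p ∙ (a ∙ b) ∙ q
  conj-∙ p q a b qp≈ε = begin
    (p ∙ a ∙ q) ∙ (p ∙ b ∙ q)  ≈⟨ solve 4 (λ p q a b →
      ((p ⊕ a) ⊕ q) ⊕ ((p ⊕ b) ⊕ q) ⊜ ((p ⊕ a) ⊕ (q ⊕ p)) ⊕ (b ⊕ q)) refl p q a b ⟩
    p ∙ a ∙ (q ∙ p) ∙ (b ∙ q)  ≈⟨ ∙-congʳ (∙-congˡ qp≈ε) ⟩
    p ∙ a ∙ ε ∙ (b ∙ q)        ≈⟨ ∙-congʳ (identityʳ (p ∙ a)) ⟩
    p ∙ a ∙ (b ∙ q)            ≈⟨ solve 4 (λ p q a b →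
      (p ⊕ a) ⊕ (b ⊕ q) ⊜ (p ⊕ (a ⊕ b)) ⊕ q) refl p q a b ⟩
    p ∙ (a ∙ b) ∙ q            ∎

  conj-cancel : ∀ p q a → p ∙ q ≈ ε → p ∙ (q ∙ a ∙ p) ∙ q ≈ a
  conj-cancel p q a pq≈ε = begin
    p ∙ (q ∙ a ∙ p) ∙ q        ≈⟨ solve 3 (λ p q a →
      (p ⊕ ((q ⊕ a) ⊕ p)) ⊕ q ⊜ ((p ⊕ q) ⊕ a) ⊕ (p ⊕ q)) refl p q a ⟩
    (p ∙ q) ∙ a ∙ (p ∙ q)      ≈⟨ ∙-cong (∙-congʳ pq≈ε) pq≈ε ⟩
    ε ∙ a ∙ ε                  ≈⟨ trans (identityʳ _) (identityˡ a) ⟩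
    a                          ∎

  conj-commute : ∀ p q a b → q ∙ p ≈ ε → a ∙ b ≈ b ∙ a →
    (p ∙ a ∙ q) ∙ (p ∙ b ∙ q) ≈ (p ∙ b ∙ q) ∙ (p ∙ a ∙ q)
  conj-commute p q a b qp≈ε ab≈ba = begin
    (p ∙ a ∙ q) ∙ (p ∙ b ∙ q)  ≈⟨ conj-∙ p q a b qp≈ε ⟩
    p ∙ (a ∙ b) ∙ q            ≈⟨ ∙-congʳ (∙-congˡ ab≈ba) ⟩
    p ∙ (b ∙ a) ∙ q            ≈⟨ conj-∙ p q b a qp≈ε ⟨
    (p ∙ b ∙ q) ∙ (p ∙ a ∙ q)  ∎

  congruence-inverse : ∀ v v′ q q′ → q ∙ v ≈ ε → q′ ∙ v′ ≈ ε →
    (q ∙ q′) ∙ (v′ ∙ ε ∙ v) ≈ ε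
  congruence-inverse v v′ q q′ qv≈ε q′v′≈ε = begin
    (q ∙ q′) ∙ (v′ ∙ ε ∙ v)  ≈⟨ ∙-congˡ (∙-congʳ (identityʳ v′)) ⟩
    (q ∙ q′) ∙ (v′ ∙ v)      ≈⟨ solve 4 (λ v v′ q q′ →
      (q ⊕ q′) ⊕ (v′ ⊕ v) ⊜ (q ⊕ (q′ ⊕ v′)) ⊕ v) refl v v′ q q′ ⟩
    q ∙ (q′ ∙ v′) ∙ v        ≈⟨ ∙-congʳ (∙-congˡ q′v′≈ε) ⟩
    q ∙ ε ∙ v                ≈⟨ ∙-congʳ (identityʳ q) ⟩
    q ∙ v                    ≈⟨ qv≈ε ⟩
    ε                        ∎

  -- Here `v′` stands for the transpose of `v`, which a monoid does not have. If Z = VᵀDV has left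
  -- inverse `z`, this moves the inverse to the middle factor D.
  inverse-of-congruence : ∀ v v′ q z d → v ∙ q ≈ ε → z ∙ (v′ ∙ d ∙ v) ≈ ε →
    (v ∙ z ∙ v′) ∙ d ≈ ε
  inverse-of-congruence v v′ q z d vq≈ε zv′dv≈ε = begin
    (v ∙ z ∙ v′) ∙ d            ≈⟨ identityʳ _ ⟨
    (v ∙ z ∙ v′) ∙ d ∙ ε        ≈⟨ ∙-congˡ vq≈ε ⟨
    (v ∙ z ∙ v′) ∙ d ∙ (v ∙ q)  ≈⟨ solve 5 (λ v v′ q z d →
      (((v ⊕ z) ⊕ v′) ⊕ d) ⊕ (v ⊕ q) ⊜ (v ⊕ (z ⊕ ((v′ ⊕ d) ⊕ v))) ⊕ q) refl v v′ q z d ⟩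
    v ∙ (z ∙ (v′ ∙ d ∙ v)) ∙ q  ≈⟨ ∙-congʳ (∙-congˡ zv′dv≈ε) ⟩
    v ∙ ε ∙ q                   ≈⟨ ∙-congʳ (identityʳ v) ⟩
    v ∙ q                       ≈⟨ vq≈ε ⟩
    ε                           ∎

  insert-inverse : ∀ v v′ q z e → q ∙ v ≈ ε →
    z ∙ (v′ ∙ e ∙ v) ≈ q ∙ ((v ∙ z ∙ v′) ∙ e) ∙ v
  insert-inverse v v′ q z e qv≈ε = begin
    z ∙ (v′ ∙ e ∙ v)                ≈⟨ identityˡ _ ⟨
    ε ∙ (z ∙ (v′ ∙ e ∙ v))          ≈⟨ ∙-congʳ qv≈ε ⟨
    (q ∙ v) ∙ (z ∙ (v′ ∙ e ∙ v))    ≈⟨ solve 5 (λ v v′ q z e →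
      (q ⊕ v) ⊕ (z ⊕ ((v′ ⊕ e) ⊕ v)) ⊜ (q ⊕ (((v ⊕ z) ⊕ v′) ⊕ e)) ⊕ v) refl v v′ q z e ⟩
    q ∙ ((v ∙ z ∙ v′) ∙ e) ∙ v      ∎

  intertwine : ∀ p q a d → p ∙ q ≈ ε → q ∙ p ≈ ε → a ∙ p ≈ p ∙ d → q ∙ a ≈ d ∙ q
  intertwine p q a d pq≈ε qp≈ε ap≈pd = begin
    q ∙ a              ≈⟨ identityʳ _ ⟨
    q ∙ a ∙ ε          ≈⟨ ∙-congˡ pq≈ε ⟨
    q ∙ a ∙ (p ∙ q)    ≈⟨ solve 3 (λ p q a → (q ⊕ a) ⊕ (p ⊕ q) ⊜ (q ⊕ (a ⊕ p)) ⊕ q) refl p q a ⟩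
    q ∙ (a ∙ p) ∙ q    ≈⟨ ∙-congʳ (∙-congˡ ap≈pd) ⟩
    q ∙ (p ∙ d) ∙ q    ≈⟨ solve 3 (λ p q d → (q ⊕ (p ⊕ d)) ⊕ q ⊜ (q ⊕ p) ⊕ (d ⊕ q)) refl p q d ⟩
    (q ∙ p) ∙ (d ∙ q)  ≈⟨ ∙-congʳ qp≈ε ⟩
    ε ∙ (d ∙ q)        ≈⟨ identityˡ _ ⟩
    d ∙ q              ∎

-- Linear algebra over a field with decidable equality

record DecidableField {c ℓ} (K : CommutativeRing c ℓ) : Set (c ⊔ ℓ) where
  open CommutativeRing K

  field
    _≈?_    : Decidable _≈_
    0≉1     : ¬ (0# ≈ 1#)
    inverse : ∀ x → ¬ (x ≈ 0#) → ∃[ y ] x * y ≈ 1#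

module LinearAlgebra {c ℓ} (K : CommutativeRing c ℓ) (F : DecidableField K) where

  open CommutativeRing K hiding (zero)
  open Tensors K
  open Algebra.Properties.Semiring.Sum semiring
  open Relation.Binary.Reasoning.Setoid setoid
  open IntegerSolver K
  open DecidableField F

  infix  8 _·_
  infixr 8 _*ᵛ_ _ᵛ*_

  _·_ : Vector Carrier n → Vector Carrier n → Carrier
  x · y = sum (λ i → x i * y i)

  _*ᵛ_ : (Fin m → Fin n → Carrier) → Vector Carrier n → Vector Carrier m
  (A *ᵛ x) i = A i · x

  _ᵛ*_ : Vector Carrier m → (Fin m → Fin n → Carrier) → Vector Carrier n
  (x ᵛ* A) j = x · λ i → A i j

  infix 4 _≈ᵛ_

  _≈ᵛ_ : Vector Carrier n → Vector Carrier n → Set ℓ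
  x ≈ᵛ y = ∀ i → x i ≈ y i

  _ᵀ : Matrix n → Matrix n
  (A ᵀ) i j = A j i

  *-cancel-≈0 : ∀ {x y} → ¬ (x ≈ 0#) → x * y ≈ 0# → y ≈ 0#
  *-cancel-≈0 {x} {y} x≉0 xy≈0 = let z , xz≈1 = inverse x x≉0 in begin
    y            ≈⟨ *-identityˡ y ⟨
    1# * y       ≈⟨ *-congʳ xz≈1 ⟨
    x * z * y    ≈⟨ solve 3 (λ x y z → x :* z :* y := z :* (x :* y)) refl x y z ⟩
    z * (x * y)  ≈⟨ *-congˡ xy≈0 ⟩
    z * 0#       ≈⟨ zeroʳ z ⟩
    0#           ∎

  sum-cong : {f g : Vector Carrier n} → f ≈ᵛ g → sum f ≈ sum g
  sum-cong = sum-cong-≋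

  sum-zero : {f : Vector Carrier n} → (∀ i → f i ≈ 0#) → sum f ≈ 0#
  sum-zero {n = n} f≈0 = trans (sum-cong f≈0) (sum-replicate-zero n)

  sum-nonzero : (f : Vector Carrier n) → ¬ (sum f ≈ 0#) → ∃[ i ] ¬ (f i ≈ 0#)
  sum-nonzero f Σf≉0 =
    Fin.¬∀⟶∃¬ _ (λ i → f i ≈ 0#) (λ i → f i ≈? 0#) (Σf≉0 ∘ sum-zero)

  sum-single : ∀ (f : Vector Carrier n) i → (∀ k → k ≢ i → f k ≈ 0#) → sum f ≈ f i
  sum-single {n = suc _} f i f≈0 = begin
    sum f                       ≈⟨ sum-remove {i = i} f ⟩
    f i + sum (removeAt f i)    ≈⟨ +-congˡ (sum-zero λ k → f≈0 _ (Fin.punchInᵢ≢i i k)) ⟩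
    f i + 0#                    ≈⟨ +-identityʳ _ ⟩
    f i                         ∎

  ·-cong : {w x y z : Vector Carrier n} → w ≈ᵛ x → y ≈ᵛ z → w · y ≈ x · z
  ·-cong w≈x y≈z = sum-cong λ i → *-cong (w≈x i) (y≈z i)

  ·-congˡ : {w y z : Vector Carrier n} → y ≈ᵛ z → w · y ≈ w · z
  ·-congˡ = ·-cong (λ _ → refl)

  ·-congʳ : {w y z : Vector Carrier n} → y ≈ᵛ z → y · w ≈ z · w
  ·-congʳ y≈z = ·-cong y≈z (λ _ → refl)

  ·-comm : (x y : Vector Carrier n) → x · y ≈ y · x
  ·-comm x y = sum-cong λ i → *-comm (x i) (y i)

  ·-assoc : ∀ (x : Vector Carrier m) A (y : Vector Carrier n) →
            (x ᵛ* A) · y ≈ x · (A *ᵛ y)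
  ·-assoc {m} {n} x A y = begin
    sum (λ j → sum (λ i → x i * A i j) * y j)    ≈⟨ sum-cong {n} (λ j → *-distribʳ-sum (y j) (λ i → x i * A i j)) ⟩
    sum (λ j → sum (λ i → x i * A i j * y j))    ≈⟨ ∑-comm (λ j i → x i * A i j * y j) ⟩
    sum (λ i → sum (λ j → x i * A i j * y j))    ≈⟨ sum-cong {m} (λ i →
                                                      sum-cong {n} λ j → *-assoc (x i) (A i j) (y j)) ⟩
    sum (λ i → sum (λ j → x i * (A i j * y j)))  ≈⟨ sum-cong {m} (λ i → *-distribˡ-sum (x i) (λ j → A i j * y j)) ⟨
    sum (λ i → x i * sum (λ j → A i j * y j))    ∎

  ·-linearʳ : ∀ (x v w : Vector Carrier n) b → x · (λ i → v i + w i * b) ≈ x · v + (x · w) * b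
  ·-linearʳ {n = zero} x v w b = solve 1 (λ b → con 0ℤ := con 0ℤ :+ con 0ℤ :* b) refl b
  ·-linearʳ {n = suc n} x v w b = trans
    (+-congˡ (·-linearʳ (x ∘ suc) (v ∘ suc) (w ∘ suc) b))
    (solve 6 (λ x v w b xv xw →
      x :* (v :+ w :* b) :+ (xv :+ xw :* b) := (x :* v :+ xv) :+ (x :* w :+ xw) :* b)
      refl (x zero) (v zero) (w zero) b _ _)

  ·-linearˡ : ∀ (v w x : Vector Carrier n) b → (λ i → v i + b * w i) · x ≈ v · x + b * (w · x)
  ·-linearˡ {n} v w x b = begin
    (λ i → v i + b * w i) · x   ≈⟨ ·-comm _ x ⟩
    x · (λ i → v i + b * w i)   ≈⟨ ·-congˡ {n} (λ i → +-congˡ (*-comm b (w i))) ⟩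
    x · (λ i → v i + w i * b)   ≈⟨ ·-linearʳ x v w b ⟩
    x · v + (x · w) * b         ≈⟨ +-cong (·-comm x v) (trans (*-comm _ b) (*-congˡ (·-comm x w))) ⟩
    v · x + b * (w · x)         ∎

  ·-bilinear : ∀ (x y v w : Vector Carrier n) a b →
    (λ i → x i + a * y i) · (λ i → v i + w i * b) ≈
    x · v + (x · w) * b + a * (y · v + (y · w) * b)
  ·-bilinear x y v w a b = trans (·-linearˡ x y _ a)
    (+-cong (·-linearʳ x v w b) (*-congˡ (·-linearʳ y v w b)))

  diagonal-≡ : ∀ (d : Vector Carrier n) i → diagonal d i i ≈ d i
  diagonal-≡ d i with i Fin.≟ i
  ... | yes _   = refl
  ... | no i≢i = contradiction ≡.refl i≢i

  diagonal-≢ : ∀ (d : Vector Carrier n) {i j} → i ≢ j → diagonal d i j ≈ 0#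
  diagonal-≢ d {i} {j} i≢j with i Fin.≟ j
  ... | yes i≡j = contradiction i≡j i≢j
  ... | no _    = refl

  diagonal-· : ∀ (d x : Vector Carrier n) i → diagonal d i · x ≈ d i * x i
  diagonal-· d x i = trans
    (sum-single _ i λ k k≢i → trans (*-congʳ (diagonal-≢ d (k≢i ∘ ≡.sym))) (zeroˡ _))
    (*-congʳ (diagonal-≡ d i))

  ·-diagonal : ∀ (x d : Vector Carrier n) j → (x · λ i → diagonal d i j) ≈ x j * d j
  ·-diagonal x d j = trans
    (sum-single _ j λ k k≢j → trans (*-congˡ (diagonal-≢ d k≢j)) (zeroʳ _))
    (*-congˡ (diagonal-≡ d j))

  1ᴹ-≡ : ∀ (i : Fin n) → 1ᴹ i i ≈ 1#
  1ᴹ-≡ = diagonal-≡ (λ _ → 1#)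

  1ᴹ-≢ : {i j : Fin n} → i ≢ j → 1ᴹ i j ≈ 0#
  1ᴹ-≢ = diagonal-≢ (λ _ → 1#)

  1ᴹ-below : ∀ {j k : Fin n} → toℕ j ℕ.< toℕ k → 1ᴹ k j ≈ 0#
  1ᴹ-below j<k = 1ᴹ-≢ λ k≡j → ℕ.<⇒≢ j<k (≡.cong toℕ (≡.sym k≡j))

  1ᴹ-· : ∀ (x : Vector Carrier n) i → 1ᴹ i · x ≈ x i
  1ᴹ-· x i = trans (diagonal-· _ x i) (*-identityˡ _)

  ·-1ᴹ : ∀ (x : Vector Carrier n) j → (x · λ i → 1ᴹ i j) ≈ x j
  ·-1ᴹ x j = trans (·-diagonal x _ j) (*-identityʳ _)

  *ᴹ-monoid : ℕ → Monoid c ℓ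
  *ᴹ-monoid n = record
    { Carrier = Matrix n
    ; _≈_     = _≈ᴹ_
    ; _∙_     = _*ᴹ_
    ; ε       = 1ᴹ
    ; isMonoid = record
      { isSemigroup = record
        { isMagma = record
          { isEquivalence = record
            { refl  = λ _ _ → refl
            ; sym   = λ A≈B i j → sym (A≈B i j)
            ; trans = λ A≈B B≈C i j → trans (A≈B i j) (B≈C i j)
            }
          ; ∙-cong = λ A≈B C≈D i j → ·-cong (A≈B i) (λ k → C≈D k j)
          }
        ; assoc = λ A B C i j → ·-assoc (A i) B (λ k → C k j)
        }
      ; identity = (λ A i j → 1ᴹ-· (λ k → A k j) i) , (λ A i j → ·-1ᴹ (A i) j)
      }
    }

  module M {n : ℕ} where
    open Monoid (*ᴹ-monoid n) public
    open Conjugation (*ᴹ-monoid n) public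

  diagonal-cong : {d e : Vector Carrier n} → d ≈ᵛ e → diagonal d ≈ᴹ diagonal e
  diagonal-cong d≈e i j with i Fin.≟ j
  ... | yes _ = d≈e i
  ... | no _  = refl

  diagonal-*-diagonal : ∀ (d e : Vector Carrier n) →
    diagonal d *ᴹ diagonal e ≈ᴹ diagonal (λ i → d i * e i)
  diagonal-*-diagonal d e i j = trans (diagonal-· d _ i) lemma
    where
    lemma : d i * diagonal e i j ≈ diagonal (λ i → d i * e i) i j
    lemma with i Fin.≟ j
    ... | yes _ = refl
    ... | no _  = zeroʳ _

  diagonal-comm : (d e : Vector Carrier n) → Commute (diagonal d) (diagonal e)
  diagonal-comm d e = M.trans (diagonal-*-diagonal d e)
    (M.trans (diagonal-cong λ i → *-comm (d i) (e i)) (M.sym (diagonal-*-diagonal e d)))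

  -- Exchanging columns of an invertible matrix

  cancel-inverse : {P Q : Matrix n} → Q *ᴹ P ≈ᴹ 1ᴹ → ∀ x → Q *ᵛ P *ᵛ x ≈ᵛ x
  cancel-inverse {P = P} {Q} QP≈1 x i = begin
    Q i · (P *ᵛ x)    ≈⟨ ·-assoc (Q i) P x ⟨
    (Q *ᴹ P) i · x    ≈⟨ ·-congʳ (QP≈1 i) ⟩
    1ᴹ i · x          ≈⟨ 1ᴹ-· x i ⟩
    x i               ∎

  -- The Sherman–Morrison formula: (P + Pxφ)⁻¹ = P⁻¹ - s x φP⁻¹ with s = (1 + φ·x)⁻¹.
  rankOneUpdate : ∀ (P : Matrix n) → Invertible P → ∀ x φ → ¬ (1# + φ · x ≈ 0#) →
    Invertible (λ i j → P i j + (P *ᵛ x) i * φ j)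
  rankOneUpdate {n} P (Q , QP≈1 , PQ≈1) x φ α≉0 =
    (λ i j → Q i j + - s * x i * ψ j) ,
    (λ i j → begin
      (λ h → Q i h + - s * x i * ψ h) · (λ h → P h j + v h * φ j)
        ≈⟨ ·-bilinear (Q i) ψ (λ h → P h j) v (- s * x i) (φ j) ⟩
      (Q *ᴹ P) i j + (Q i · v) * φ j + - s * x i * ((ψ ᵛ* P) j + (ψ · v) * φ j)
        ≈⟨ +-cong (+-cong (QP≈1 i j) (*-congʳ (cancel-inverse QP≈1 x i)))
                  (*-congˡ (+-cong (ψP≈φ j) (*-congʳ ψv≈φx))) ⟩
      1ᴹ i j + x i * φ j + - s * x i * (φ j + (φ · x) * φ j)
        ≈⟨ solve 5 (λ δ x φ s a →
             δ :+ x :* φ :+ :- s :* x :* (φ :+ a :* φ) :=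
             δ :+ x :* φ :* (con 1ℤ :- (con 1ℤ :+ a) :* s))
             refl (1ᴹ i j) (x i) (φ j) s (φ · x) ⟩
      1ᴹ i j + x i * φ j * (1# - (1# + φ · x) * s)
        ≈⟨ cancel (1ᴹ i j) (x i * φ j) ⟩
      1ᴹ i j ∎) ,
    λ i j → begin
      (λ h → P i h + v i * φ h) · (λ h → Q h j + - s * x h * ψ j)
        ≈⟨ ·-bilinear (P i) φ (λ h → Q h j) (λ h → - s * x h) (v i) (ψ j) ⟩
      (P *ᴹ Q) i j + (P i · λ h → - s * x h) * ψ j + v i * (ψ j + (φ · λ h → - s * x h) * ψ j)
        ≈⟨ +-cong (+-cong (PQ≈1 i j) (*-congʳ (pull (P i))))
                  (*-congˡ (+-congˡ (*-congʳ (pull φ)))) ⟩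
      1ᴹ i j + - s * v i * ψ j + v i * (ψ j + - s * (φ · x) * ψ j)
        ≈⟨ solve 5 (λ δ v ψ s a →
             δ :+ :- s :* v :* ψ :+ v :* (ψ :+ :- s :* a :* ψ) :=
             δ :+ v :* ψ :* (con 1ℤ :- (con 1ℤ :+ a) :* s))
             refl (1ᴹ i j) (v i) (ψ j) s (φ · x) ⟩
      1ᴹ i j + v i * ψ j * (1# - (1# + φ · x) * s)
        ≈⟨ cancel (1ᴹ i j) (v i * ψ j) ⟩
      1ᴹ i j ∎
    where
    v = P *ᵛ x
    ψ = φ ᵛ* Q
    s = proj₁ (inverse _ α≉0)

    ψP≈φ : ψ ᵛ* P ≈ᵛ φ
    ψP≈φ j = begin
      ψ · (λ i → P i j)             ≈⟨ ·-assoc φ Q _ ⟩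
      φ · (λ i → (Q *ᴹ P) i j)      ≈⟨ ·-congˡ (λ i → QP≈1 i j) ⟩
      φ · (λ i → 1ᴹ i j)            ≈⟨ ·-1ᴹ φ j ⟩
      φ j                           ∎

    ψv≈φx : ψ · v ≈ φ · x
    ψv≈φx = trans (·-assoc φ Q v) (·-congˡ (cancel-inverse QP≈1 x))

    pull : ∀ y → (y · λ h → - s * x h) ≈ - s * (y · x)
    pull y = trans
      (sum-cong {n} λ h → solve 3 (λ s x y → y :* (:- s :* x) := :- s :* (y :* x)) refl s (x h) (y h))
      (sym (*-distribˡ-sum (- s) (λ h → y h * x h)))

    cancel : ∀ a b → a + b * (1# - (1# + φ · x) * s) ≈ a
    cancel a b = begin
      a + b * (1# - (1# + φ · x) * s)  ≈⟨ +-congˡ (*-congˡ (+-congˡ (-‿cong (proj₂ (inverse _ α≉0))))) ⟩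
      a + b * (1# - 1#)                ≈⟨ solve 2 (λ a b → a :+ b :* (con 1ℤ :- con 1ℤ) := a) refl a b ⟩
      a                                ∎

  -- The new matrix is P(1 + xφ) with x = P⁻¹w - e_k, so column j gains φ_j (w - P_k). Since φ_k =
  -- 1, the Sherman-Morrison denominator 1 + φ · x collapses to φ · P⁻¹w.
  replaceColumn : ∀ (P : Matrix n) (P⁻¹ : Invertible P) k w φ → φ k ≈ 1# →
    ¬ (φ · (inv P P⁻¹ *ᵛ w) ≈ 0#) →
    ∃ λ P′ → Invertible P′ × (∀ i → P′ i k ≈ w i) ×
      (∀ j → φ j ≈ 0# → ∀ i → P′ i j ≈ P i j)
  replaceColumn P P⁻¹@(Q , QP≈1 , PQ≈1) k w φ φₖ≈1 φQw≉0 =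
    (λ i j → P i j + (P *ᵛ x) i * φ j) ,
    rankOneUpdate P P⁻¹ x φ (λ eq → φQw≉0 (trans (sym 1+φx≈φQw) eq)) ,
    (λ i → begin
      P i k + (P i · x) * φ k            ≈⟨ +-congˡ (*-cong (Px≈w-p i) φₖ≈1) ⟩
      P i k + (w i + P i k * - 1#) * 1#  ≈⟨ solve 2 (λ p w →
        p :+ (w :+ p :* :- con 1ℤ) :* con 1ℤ := w) refl (P i k) (w i) ⟩
      w i                                ∎) ,
    λ j φⱼ≈0 i → begin
      P i j + (P i · x) * φ j  ≈⟨ +-congˡ (trans (*-congˡ φⱼ≈0) (zeroʳ _)) ⟩
      P i j + 0#               ≈⟨ +-identityʳ _ ⟩
      P i j                    ∎
    where
    x : Vector Carrier _
    x i = (Q *ᵛ w) i + 1ᴹ i k * - 1#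

    Px≈w-p : ∀ i → P i · x ≈ w i + P i k * - 1#
    Px≈w-p i = begin
      P i · x                                               ≈⟨ ·-linearʳ (P i) (Q *ᵛ w) (λ h → 1ᴹ h k) (- 1#) ⟩
      P i · (Q *ᵛ w) + (P i · λ h → 1ᴹ h k) * - 1#          ≈⟨ +-cong (cancel-inverse PQ≈1 w i)
                                                                      (*-congʳ (·-1ᴹ (P i) k)) ⟩
      w i + P i k * - 1#                                    ∎

    1+φx≈φQw : 1# + φ · x ≈ φ · (Q *ᵛ w)
    1+φx≈φQw = begin
      1# + φ · x                                            ≈⟨ +-congˡ (·-linearʳ φ (Q *ᵛ w) (λ h → 1ᴹ h k) (- 1#)) ⟩
      1# + (φ · (Q *ᵛ w) + (φ · λ h → 1ᴹ h k) * - 1#)       ≈⟨ +-congˡ (+-congˡ (*-congʳ (trans (·-1ᴹ φ k) φₖ≈1))) ⟩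
      1# + (φ · (Q *ᵛ w) + 1# * - 1#)                       ≈⟨ solve 1 (λ a →
        con 1ℤ :+ (a :+ con 1ℤ :* :- con 1ℤ) := a) refl (φ · (Q *ᵛ w)) ⟩
      φ · (Q *ᵛ w)                                          ∎

  -- Only columns before k must survive step k, so φ is constrained only there; later columns may be
  -- altered because they are still to be replaced. `Good` may depend on the position, which lets
  -- one construction serve both prescribed columns and eigenvectors.
  buildBasis : ∀ {p} (Good : Fin r → Pred (Vector Carrier r) p) →
    (∀ k {v w} → v ≈ᵛ w → Good k w → Good k v) →
    (∀ k (P : Matrix r) (P⁻¹ : Invertible P) →
      (∀ j → toℕ j ℕ.< toℕ k → Good j (λ i → P i j)) →
      ∃[ w ] ∃[ φ ] Good k w × φ k ≈ 1# × (∀ j → toℕ j ℕ.< toℕ k → φ j ≈ 0#) ×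
        ¬ (φ · (inv P P⁻¹ *ᵛ w) ≈ 0#)) →
    ∃ λ (P : Matrix r) → Invertible P × ∀ j → Good j (λ i → P i j)
  buildBasis {r = r} Good resp step =
    let P , P⁻¹ , good = go r ℕ.≤-refl in P , P⁻¹ , λ j → good j (Fin.toℕ<n j)
    where
    GoodUpTo : ℕ → Matrix r → Set _
    GoodUpTo k P = Invertible P × ∀ j → toℕ j ℕ.< k → Good j (λ i → P i j)

    next : ∀ k P → GoodUpTo (toℕ k) P → ∃ (GoodUpTo (suc (toℕ k)))
    next k P (P⁻¹ , good) =
      let w , φ , good-w , φₖ≈1 , φ≈0 , φQw≉0 = step k P P⁻¹ good
          P′ , P′⁻¹ , new , old = replaceColumn P P⁻¹ k w φ φₖ≈1 φQw≉0
      in P′ , P′⁻¹ , good′ P′ w φ good-w φ≈0 new old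
      where
      good′ : ∀ (P′ : Matrix r) (w φ : Vector Carrier r) → Good k w → (∀ j → toℕ j ℕ.< toℕ k → φ j ≈ 0#) →
        (∀ i → P′ i k ≈ w i) → (∀ j → φ j ≈ 0# → ∀ i → P′ i j ≈ P i j) →
        ∀ j → toℕ j ℕ.< suc (toℕ k) → Good j (λ i → P′ i j)
      good′ P′ w φ good-w φ≈0 new old j j≤k with j Fin.≟ k
      ... | yes ≡.refl = resp k new good-w
      ... | no j≢k     = resp j (old j (φ≈0 j j<k)) (good j j<k)
        where j<k = ℕ.≤∧≢⇒< (ℕ.s≤s⁻¹ j≤k) (j≢k ∘ Fin.toℕ-injective)

    go : ∀ k → k ℕ.≤ r → ∃ (GoodUpTo k)
    go zero    _   = 1ᴹ , (1ᴹ , M.identityˡ 1ᴹ , M.identityˡ 1ᴹ) , λ _ ()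
    go (suc k) k<r =
      let P , good = go k (ℕ.<⇒≤ k<r)
          k≡ = Fin.toℕ-fromℕ< k<r
          P′ , good′ = next (fromℕ< k<r) P (≡.subst (λ k → GoodUpTo k P) (≡.sym k≡) good)
      in P′ , ≡.subst (λ k → GoodUpTo (suc k) P′) k≡ good′

  -- Simultaneous diagonalization

  sandwich : ∀ (P Q : Matrix n) d i j →
    (P *ᴹ diagonal d *ᴹ Q) i j ≈ sum (λ m → d m * (P i m * Q m j))
  sandwich {n} P Q d i j = sum-cong {n} λ m → begin
    (P i · λ h → diagonal d h m) * Q m j  ≈⟨ *-congʳ (·-diagonal (P i) d m) ⟩
    P i m * d m * Q m j                   ≈⟨ *-congʳ (*-comm (P i m) (d m)) ⟩
    d m * P i m * Q m j                   ≈⟨ *-assoc (d m) (P i m) (Q m j) ⟩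
    d m * (P i m * Q m j)                 ∎

  -- Replacing an eigenvalue by the index of its first occurrence turns _≈_ into _≡_.
  representative : Vector Carrier n → Fin n → Fin n
  representative d zero    = zero
  representative d (suc i) with d (suc i) ≈? d zero
  ... | yes _ = zero
  ... | no _  = suc (representative (d ∘ suc) i)

  representative-≈ : ∀ (d : Vector Carrier n) i → d (representative d i) ≈ d i
  representative-≈ d zero    = refl
  representative-≈ d (suc i) with d (suc i) ≈? d zero
  ... | yes dᵢ≈d₀ = sym dᵢ≈d₀
  ... | no _      = representative-≈ (d ∘ suc) i

  representative-≡ : ∀ (d : Vector Carrier n) i j → d i ≈ d j →
    representative d i ≡ representative d j
  representative-≡ d zero zero _ = ≡.refl
  representative-≡ d zero (suc j) d₀≈dⱼ with d (suc j) ≈? d zero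
  ... | yes _    = ≡.refl
  ... | no dⱼ≉d₀ = contradiction (sym d₀≈dⱼ) dⱼ≉d₀
  representative-≡ d (suc i) zero dᵢ≈d₀ with d (suc i) ≈? d zero
  ... | yes _    = ≡.refl
  ... | no dᵢ≉d₀ = contradiction dᵢ≈d₀ dᵢ≉d₀
  representative-≡ d (suc i) (suc j) dᵢ≈dⱼ with d (suc i) ≈? d zero | d (suc j) ≈? d zero
  ... | yes _     | yes _     = ≡.refl
  ... | yes dᵢ≈d₀ | no dⱼ≉d₀  = contradiction (trans (sym dᵢ≈dⱼ) dᵢ≈d₀) dⱼ≉d₀
  ... | no dᵢ≉d₀  | yes dⱼ≈d₀ = contradiction (trans dᵢ≈dⱼ dⱼ≈d₀) dᵢ≉d₀
  ... | no _      | no _      = ≡.cong suc (representative-≡ (d ∘ suc) i j dᵢ≈dⱼ)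

  -- Commuting with `diagonal d` forces B i j = 0 wherever d i and d j differ, so any diagonal that
  -- is constant on equal entries of d commutes with B too. This replaces writing a spectral
  -- projection as a polynomial in the matrix.
  diagonal-commute : ∀ (d e : Vector Carrier n) B →
    (∀ i j → d i ≈ d j → e i ≈ e j) → Commute (diagonal d) B → Commute (diagonal e) B
  diagonal-commute d e B d≈⇒e≈ dB≈Bd i j = begin
    diagonal e i · (λ k → B k j)   ≈⟨ diagonal-· e _ i ⟩
    e i * B i j                    ≈⟨ lemma ⟩
    B i j * e j                    ≈⟨ ·-diagonal (B i) e j ⟨
    (B i · λ k → diagonal e k j)   ∎
    where
    dB≈Bd′ : d i * B i j ≈ B i j * d j
    dB≈Bd′ = trans (sym (diagonal-· d (λ k → B k j) i)) (trans (dB≈Bd i j) (·-diagonal (B i) d j))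

    lemma : e i * B i j ≈ B i j * e j
    lemma with d i ≈? d j
    ... | yes dᵢ≈dⱼ = trans (*-congʳ (d≈⇒e≈ i j dᵢ≈dⱼ)) (*-comm (e j) (B i j))
    ... | no dᵢ≉dⱼ  = trans (*-congˡ B≈0) (trans (zeroʳ (e i)) (sym (trans (*-congʳ B≈0) (zeroˡ (e j)))))
      where
      B≈0 : B i j ≈ 0#
      B≈0 = *-cancel-≈0 {d i - d j}
        (λ dᵢ-dⱼ≈0 → dᵢ≉dⱼ (begin
          d i              ≈⟨ solve 2 (λ x y → x := x :- y :+ y) refl (d i) (d j) ⟩
          d i - d j + d j  ≈⟨ +-congʳ dᵢ-dⱼ≈0 ⟩
          0# + d j         ≈⟨ +-identityˡ (d j) ⟩
          d j              ∎))
        (begin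
          (d i - d j) * B i j          ≈⟨ solve 3 (λ x y b →
            (x :- y) :* b := x :* b :- b :* y) refl (d i) (d j) (B i j) ⟩
          d i * B i j - B i j * d j    ≈⟨ +-congʳ dB≈Bd′ ⟩
          B i j * d j - B i j * d j    ≈⟨ -‿inverseʳ (B i j * d j) ⟩
          0#                           ∎)

  Eigenvector : Matrix n → Vector Carrier n → Set (c ⊔ ℓ)
  Eigenvector A w = ∃[ a ] (A *ᵛ w ≈ᵛ λ i → a * w i)

  ·-scale : ∀ (x y : Vector Carrier n) a → (x · λ i → a * y i) ≈ a * (x · y)
  ·-scale {n} x y a = begin
    sum (λ i → x i * (a * y i))  ≈⟨ sum-cong {n} (λ i → solve 3 (λ x a y →
      x :* (a :* y) := a :* (x :* y)) refl (x i) a (y i)) ⟩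
    sum (λ i → a * (x i * y i))  ≈⟨ *-distribˡ-sum a (λ i → x i * y i) ⟨
    a * sum (λ i → x i * y i)    ∎

  -- The projection onto some eigenspace along the others: since w is the sum of
  -- its projections, φ cannot vanish on all of them.
  spectralProjection : ∀ (A : Matrix n) → Diagonalizable A →
    ∀ φ w → ¬ (φ · w ≈ 0#) →
    ∃[ E ] (∀ B → Commute A B → Commute E B) ×
      (∃[ a ] A *ᴹ E ≈ᴹ λ i j → a * E i j) × ¬ (φ · (E *ᵛ w) ≈ 0#)
  spectralProjection {n} A (P , d , (Q , QP≈1 , PQ≈1) , QAP≈d) φ w φw≉0 =
    let l , φEw≉0 = sum-nonzero (λ l → φ · (E l *ᵛ w)) (λ eq → φw≉0 (trans (sym ΣφEw≈φw) eq))
    in E l , commutes l , (d l , eigen l) , φEw≉0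
    where
    -- The indicator of the positions whose eigenvalue first occurs at l. It vanishes when l is not
    -- a first occurrence, so summing over all l counts each eigenspace once.
    χ : Fin n → Vector Carrier n
    χ l m = 1ᴹ (representative d m) l

    E : Fin n → Matrix n
    E l = P *ᴹ diagonal (χ l) *ᴹ Q

    ΣE≈1 : ∀ i j → sum (λ l → E l i j) ≈ 1ᴹ i j
    ΣE≈1 i j = begin
      sum (λ l → E l i j)
        ≈⟨ sum-cong {n} (λ l → sandwich P Q (χ l) i j) ⟩
      sum (λ l → sum (λ m → χ l m * (P i m * Q m j)))
        ≈⟨ ∑-comm (λ l m → χ l m * (P i m * Q m j)) ⟩
      sum (λ m → sum (λ l → χ l m * (P i m * Q m j)))
        ≈⟨ sum-cong {n} (λ m → 1ᴹ-· (λ _ → P i m * Q m j) (representative d m)) ⟩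
      (P *ᴹ Q) i j
        ≈⟨ PQ≈1 i j ⟩
      1ᴹ i j ∎

    ΣφEw≈φw : sum (λ l → φ · (E l *ᵛ w)) ≈ φ · w
    ΣφEw≈φw = begin
      sum (λ l → sum (λ i → φ i * (E l *ᵛ w) i))
        ≈⟨ ∑-comm (λ l i → φ i * (E l *ᵛ w) i) ⟩
      sum (λ i → sum (λ l → φ i * (E l *ᵛ w) i))
        ≈⟨ sum-cong {n} (λ i → sym (*-distribˡ-sum (φ i) (λ l → (E l *ᵛ w) i))) ⟩
      sum (λ i → φ i * sum (λ l → (E l *ᵛ w) i))
        ≈⟨ sum-cong {n} (λ i → *-congˡ (begin
          sum (λ l → sum (λ j → E l i j * w j))   ≈⟨ ∑-comm (λ l j → E l i j * w j) ⟩
          sum (λ j → sum (λ l → E l i j * w j))   ≈⟨ sum-cong {n} (λ j → *-distribʳ-sum (w j) (λ l → E l i j)) ⟨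
          sum (λ j → sum (λ l → E l i j) * w j)   ≈⟨ sum-cong {n} (λ j → *-congʳ (ΣE≈1 i j)) ⟩
          1ᴹ i · w                                ≈⟨ 1ᴹ-· w i ⟩
          w i                                     ∎)) ⟩
      φ · w ∎

    -- In the eigenbasis, B becomes QBP, which commutes with `diagonal d` and hence with the
    -- indicator of an eigenspace.
    commutes : ∀ l B → Commute A B → Commute (E l) B
    commutes l B AB≈BA = M.trans (M.∙-congˡ (M.sym B≈))
      (M.trans (M.conj-commute P Q (diagonal (χ l)) B′ QP≈1
        (diagonal-commute d (χ l) B′ (λ i j dᵢ≈dⱼ →
            reflexive (≡.cong (λ k → 1ᴹ k l) (representative-≡ d i j dᵢ≈dⱼ)))
          (M.trans (M.∙-congʳ (M.sym QAP≈d)) (M.trans (M.conj-commute Q P A B PQ≈1 AB≈BA) (M.∙-congˡ QAP≈d)))))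
      (M.∙-congʳ B≈))
      where
      B′ = Q *ᴹ B *ᴹ P
      B≈ = M.conj-cancel P Q B PQ≈1

    dχ≈dₗχ : ∀ l m → d m * χ l m ≈ d l * χ l m
    dχ≈dₗχ l m with representative d m Fin.≟ l
    ... | yes ≡.refl = *-congʳ (sym (representative-≈ d m))
    ... | no _       = trans (zeroʳ (d m)) (sym (zeroʳ (d l)))

    eigen : ∀ l → A *ᴹ E l ≈ᴹ λ i j → d l * E l i j
    eigen l i j = begin
      (A *ᴹ E l) i j
        ≈⟨ M.∙-congʳ {_} {E l} (M.sym (M.conj-cancel P Q A PQ≈1)) i j ⟩
      (P *ᴹ (Q *ᴹ A *ᴹ P) *ᴹ Q *ᴹ E l) i j
        ≈⟨ M.conj-∙ P Q (Q *ᴹ A *ᴹ P) (diagonal (χ l)) QP≈1 i j ⟩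
      (P *ᴹ (Q *ᴹ A *ᴹ P *ᴹ diagonal (χ l)) *ᴹ Q) i j
        ≈⟨ M.∙-congʳ {_} {Q} (M.∙-congˡ {_} {P} (M.trans (M.∙-congʳ QAP≈d)
             (M.trans (diagonal-*-diagonal d (χ l)) (diagonal-cong (dχ≈dₗχ l))))) i j ⟩
      (P *ᴹ diagonal (λ m → d l * χ l m) *ᴹ Q) i j
        ≈⟨ sandwich P Q _ i j ⟩
      sum (λ m → d l * χ l m * (P i m * Q m j))
        ≈⟨ sum-cong {n} (λ m → *-assoc (d l) (χ l m) (P i m * Q m j)) ⟩
      sum (λ m → d l * (χ l m * (P i m * Q m j)))
        ≈⟨ *-distribˡ-sum (d l) (λ m → χ l m * (P i m * Q m j)) ⟨
      d l * sum (λ m → χ l m * (P i m * Q m j))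
        ≈⟨ *-congˡ (sandwich P Q (χ l) i j) ⟨
      d l * E l i j ∎

  -- Project a joint eigenvector of the tail to an eigenspace of the head. The projection commutes
  -- with whatever commutes with the head, so the eigenvalues of the tail persist, and it is chosen
  -- so that φ still does not vanish.
  commonEigenvector : ∀ (A : Vector (Matrix n) m) →
    (∀ i j → Commute (A i) (A j)) → (∀ i → Diagonalizable (A i)) →
    ∀ φ w → ¬ (φ · w ≈ 0#) → ∃[ w′ ] (∀ k → Eigenvector (A k) w′) × ¬ (φ · w′ ≈ 0#)
  commonEigenvector {m = zero}  A comm diag φ w φw≉0 = w , (λ ()) , φw≉0
  commonEigenvector {m = suc m} A comm diag φ w φw≉0 =
    let w₁ , eigen₁ , φw₁≉0 = commonEigenvector (A ∘ suc)
          (λ i j → comm (suc i) (suc j)) (diag ∘ suc) φ w φw≉0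
        E , E-comm , (a , AE≈aE) , φEw₁≉0 = spectralProjection (A zero) (diag zero) φ w₁ φw₁≉0
    in E *ᵛ w₁ , eigen w₁ eigen₁ E E-comm a AE≈aE , φEw₁≉0
    where
    eigen : ∀ w₁ → (∀ k → Eigenvector (A (suc k)) w₁) →
      ∀ E → (∀ B → Commute (A zero) B → Commute E B) →
      ∀ a → A zero *ᴹ E ≈ᴹ (λ i j → a * E i j) → ∀ k → Eigenvector (A k) (E *ᵛ w₁)
    eigen w₁ eigen₁ E E-comm a AE≈aE zero = a , λ i → begin
      A zero i · (E *ᵛ w₁)             ≈⟨ ·-assoc (A zero i) E w₁ ⟨
      (A zero *ᴹ E) i · w₁             ≈⟨ ·-congʳ (AE≈aE i) ⟩
      (λ j → a * E i j) · w₁           ≈⟨ ·-comm _ w₁ ⟩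
      (w₁ · λ j → a * E i j)           ≈⟨ ·-scale w₁ (E i) a ⟩
      a * (w₁ · E i)                   ≈⟨ *-congˡ (·-comm w₁ (E i)) ⟩
      a * (E i · w₁)                   ∎
    eigen w₁ eigen₁ E E-comm a AE≈aE (suc k) = let b , Bw₁≈bw₁ = eigen₁ k in b , λ i → begin
      B i · (E *ᵛ w₁)                  ≈⟨ ·-assoc (B i) E w₁ ⟨
      (B *ᴹ E) i · w₁                  ≈⟨ ·-congʳ (λ j → E-comm B (comm zero (suc k)) i j) ⟨
      (E *ᴹ B) i · w₁                  ≈⟨ ·-assoc (E i) B w₁ ⟩
      E i · (B *ᵛ w₁)                  ≈⟨ ·-congˡ Bw₁≈bw₁ ⟩
      (E i · λ j → b * w₁ j)           ≈⟨ ·-scale (E i) w₁ b ⟩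
      b * (E i · w₁)                   ∎
      where B = A (suc k)

  -- At step k the functional is row k of P⁻¹ and the starting vector is column k of P, which pair
  -- to 1. The joint eigenvector obtained from them has a nonzero k-th coordinate in the basis P, so
  -- it can replace column k.
  commonEigenbasis : ∀ (A : Vector (Matrix n) m) →
    (∀ i j → Commute (A i) (A j)) → (∀ i → Diagonalizable (A i)) →
    ∃ λ (P : Matrix n) → Invertible P × ∀ j k → Eigenvector (A k) (λ i → P i j)
  commonEigenbasis {n} A comm diag = buildBasis
    (λ _ w → ∀ k → Eigenvector (A k) w)
    (λ _ v≈w eigen k → let a , Aw≈aw = eigen k in
      a , λ i → trans (·-congˡ v≈w) (trans (Aw≈aw i) (*-congˡ (sym (v≈w i)))))
    λ { k P (Q , QP≈1 , _) _ →
      let w , eigen , Qw≉0 = commonEigenvector A comm diag (Q k) (λ i → P i k)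
            (λ eq → 0≉1 (trans (sym eq) (trans (QP≈1 k k) (1ᴹ-≡ k))))
      in w , 1ᴹ k , eigen , 1ᴹ-≡ k ,
         (λ _ → 1ᴹ-below) ,
         λ eq → Qw≉0 (trans (sym (1ᴹ-· (Q *ᵛ w) k)) eq) }

-- Extending independent columns to an invertible matrix

module SymmetricTensors {c ℓ} (K : CommutativeRing c ℓ) (F : DecidableField K) where

  open CommutativeRing K hiding (zero)
  open Tensors K
  open Algebra.Properties.Semiring.Sum semiring
  open Relation.Binary.Reasoning.Setoid setoid
  open IntegerSolver K
  open DecidableField F
  open LinearAlgebra K F

  extendColumns : ∀ .(n≤r : n ℕ.≤ r) (u : Vector (Vector Carrier n) r) (L : Fin n → Vector Carrier r) →
    (∀ i j → (L i · λ l → u l j) ≈ 1ᴹ i j) →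
    ∃ λ (V : Matrix r) → Invertible V × ∀ i l → V l (inject≤ i n≤r) ≈ u l i
  extendColumns {n} {r} n≤r u L LU≈1 =
    let V , V⁻¹ , good = buildBasis Good
          (λ k v≈w good i i≡k l → trans (v≈w l) (good i i≡k l)) step
    in V , V⁻¹ , λ i → good (inject≤ i n≤r) i ≡.refl
    where
    -- Vacuous for positions k ≥ n, where no column is prescribed.
    Good : Fin r → Pred (Vector Carrier r) ℓ
    Good k v = ∀ i → inject≤ i n≤r ≡ k → ∀ l → v l ≈ u l i

    Step : ∀ k (P : Matrix r) → Invertible P → Set _
    Step k P P⁻¹ = ∃[ w ] ∃[ φ ] Good k w × φ k ≈ 1# × (∀ j → toℕ j ℕ.< toℕ k → φ j ≈ 0#) ×
      ¬ (φ · (inv P P⁻¹ *ᵛ w) ≈ 0#)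

    below : ∀ j (j<n : toℕ j ℕ.< n) → inject≤ (fromℕ< j<n) n≤r ≡ j
    below j j<n = Fin.toℕ-injective
      (≡.trans (Fin.toℕ-inject≤ (fromℕ< j<n) n≤r) (Fin.toℕ-fromℕ< j<n))

    good-column : ∀ k (k<n : toℕ k ℕ.< n) → Good k (λ l → u l (fromℕ< k<n))
    good-column k k<n i i≡k l = reflexive (≡.cong (u l)
      (Fin.inject≤-injective n≤r n≤r (fromℕ< k<n) i (≡.trans (below k k<n) (≡.sym i≡k))))

    stepBelow : ∀ k P P⁻¹ → toℕ k ℕ.< n →
      (∀ j → toℕ j ℕ.< toℕ k → Good j (λ i → P i j)) → Step k P P⁻¹
    -- The k-th coordinate of P⁻¹w is the pivot: if it is nonzero, e_k itself serves as φ.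
    stepBelow k P (Q , QP≈1 , PQ≈1) k<n good with (Q *ᵛ λ l → u l (fromℕ< k<n)) k ≈? 0#
    ... | no y≉0 = w , 1ᴹ k , good-column k k<n , 1ᴹ-≡ k , (λ _ → 1ᴹ-below) ,
            λ eq → y≉0 (trans (sym (1ᴹ-· (Q *ᵛ w) k)) eq)
      where w = λ l → u l (fromℕ< k<n)
    ... | yes y≈0 = w , φ , good-column k k<n , φₖ≈1 , φⱼ≈0 , φQw≉0
      where
      i₀ = fromℕ< k<n
      w = λ l → u l i₀

      ρ : Vector Carrier r
      ρ = L i₀ ᵛ* P

      -- e_k vanishes on P⁻¹w here; ρ takes the value 1 on it, since L U = 1.
      φ : Vector Carrier r
      φ j = ρ j + (1# - ρ k) * 1ᴹ k j

      φₖ≈1 : φ k ≈ 1#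
      φₖ≈1 = begin
        ρ k + (1# - ρ k) * 1ᴹ k k  ≈⟨ +-congˡ (*-congˡ (1ᴹ-≡ k)) ⟩
        ρ k + (1# - ρ k) * 1#      ≈⟨ solve 1 (λ x → x :+ (con 1ℤ :- x) :* con 1ℤ := con 1ℤ) refl (ρ k) ⟩
        1#                         ∎

      φⱼ≈0 : ∀ j → toℕ j ℕ.< toℕ k → φ j ≈ 0#
      φⱼ≈0 j j<k = begin
        ρ j + (1# - ρ k) * 1ᴹ k j  ≈⟨ +-cong ρⱼ≈0 (trans (*-congˡ (1ᴹ-below j<k)) (zeroʳ (1# - ρ k))) ⟩
        0# + 0#                    ≈⟨ +-identityˡ 0# ⟩
        0#                         ∎
        where
        j<n = ℕ.<-trans j<k k<n
        iⱼ = fromℕ< j<n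

        i₀≢iⱼ : i₀ ≢ iⱼ
        i₀≢iⱼ i₀≡iⱼ = ℕ.<⇒≢ j<k (≡.trans (≡.sym (Fin.toℕ-fromℕ< j<n))
          (≡.trans (≡.cong toℕ (≡.sym i₀≡iⱼ)) (Fin.toℕ-fromℕ< k<n)))

        ρⱼ≈0 : ρ j ≈ 0#
        ρⱼ≈0 = begin
          (L i₀ · λ l → P l j)    ≈⟨ ·-congˡ (good j j<k iⱼ (below j j<n)) ⟩
          (L i₀ · λ l → u l iⱼ)   ≈⟨ LU≈1 i₀ iⱼ ⟩
          1ᴹ i₀ iⱼ                ≈⟨ 1ᴹ-≢ i₀≢iⱼ ⟩
          0#                      ∎

      φQw≉0 : ¬ (φ · (Q *ᵛ w) ≈ 0#)
      φQw≉0 φQw≈0 = 0≉1 (begin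
        0#                                       ≈⟨ φQw≈0 ⟨
        φ · (Q *ᵛ w)                             ≈⟨ ·-linearˡ ρ (1ᴹ k) (Q *ᵛ w) (1# - ρ k) ⟩
        ρ · (Q *ᵛ w) + (1# - ρ k) * (1ᴹ k · (Q *ᵛ w))
          ≈⟨ +-cong (·-assoc (L i₀) P (Q *ᵛ w)) (*-congˡ (trans (1ᴹ-· (Q *ᵛ w) k) y≈0)) ⟩
        L i₀ · (P *ᵛ Q *ᵛ w) + (1# - ρ k) * 0#   ≈⟨ +-cong (·-congˡ (cancel-inverse PQ≈1 w)) (zeroʳ (1# - ρ k)) ⟩
        L i₀ · w + 0#                            ≈⟨ +-identityʳ (L i₀ · w) ⟩
        L i₀ · w                                 ≈⟨ LU≈1 i₀ i₀ ⟩
        1ᴹ i₀ i₀                                 ≈⟨ 1ᴹ-≡ i₀ ⟩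
        1#                                       ∎)

    step : ∀ k P P⁻¹ → (∀ j → toℕ j ℕ.< toℕ k → Good j (λ i → P i j)) → Step k P P⁻¹
    step k P P⁻¹ good with toℕ k ℕ.<? n
    ... | yes k<n = stepBelow k P P⁻¹ k<n good
    -- Nothing is prescribed here, so column k is exchanged for itself: P⁻¹ sends it to e_k, on
    -- which e_k takes the value 1.
    ... | no k≮n  = (λ i → P i k) , 1ᴹ k ,
      (λ { i ≡.refl → contradiction
        (≡.subst (ℕ._< n) (≡.sym (Fin.toℕ-inject≤ i n≤r)) (Fin.toℕ<n i)) k≮n }) ,
      1ᴹ-≡ k , (λ _ → 1ᴹ-below) ,
      λ eq → 0≉1 (begin
        0#                                         ≈⟨ eq ⟨
        1ᴹ k · (inv P P⁻¹ *ᵛ λ i → P i k)          ≈⟨ 1ᴹ-· (inv P P⁻¹ *ᵛ λ i → P i k) k ⟩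
        (inv P P⁻¹ *ᴹ P) k k                       ≈⟨ proj₁ (proj₂ P⁻¹) k k ⟩
        1ᴹ k k                                     ≈⟨ 1ᴹ-≡ k ⟩
        1#                                         ∎)

  -- Slices of a sum of cubes

  cubes : Vector (Vector Carrier n) r → Tensor n
  cubes u i j k = sum (λ l → (u l ^⊗3) i j k)

  span-cubes : ∀ (u : Vector (Vector Carrier n) r) a i j →
    sum (λ k → a k * cubes u i j k) ≈ sum (λ l → (a · u l) * (u l i * u l j))
  span-cubes {n} {r} u a i j = begin
    sum (λ k → a k * sum (λ l → u l i * u l j * u l k))
      ≈⟨ sum-cong {n} (λ k → *-distribˡ-sum (a k) (λ l → u l i * u l j * u l k)) ⟩
    sum (λ k → sum (λ l → a k * (u l i * u l j * u l k)))
      ≈⟨ ∑-comm (λ k l → a k * (u l i * u l j * u l k)) ⟩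
    sum (λ l → sum (λ k → a k * (u l i * u l j * u l k)))
      ≈⟨ sum-cong {r} (λ l → sum-cong {n} λ k → solve 4
           (λ a x y z → a :* (x :* y :* z) := a :* z :* (x :* y)) refl (a k) (u l i) (u l j) (u l k)) ⟩
    sum (λ l → sum (λ k → a k * u l k * (u l i * u l j)))
      ≈⟨ sum-cong {r} (λ l → *-distribʳ-sum (u l i * u l j) (λ k → a k * u l k)) ⟨
    sum (λ l → (a · u l) * (u l i * u l j)) ∎

  cubes-symmetric : (u : Vector (Vector Carrier n) r) → Symmetric (cubes u)
  cubes-symmetric {r = r} u i j k =
    sum-cong {r} (λ l → solve 3 (λ x y z → x :* y :* z := x :* z :* y) refl (u l i) (u l j) (u l k)) ,
    sum-cong {r} (λ l → solve 3 (λ x y z → x :* y :* z := y :* x :* z) refl (u l i) (u l j) (u l k)) ,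
    sum-cong {r} (λ l → solve 3 (λ x y z → x :* y :* z := y :* z :* x) refl (u l i) (u l j) (u l k)) ,
    sum-cong {r} (λ l → solve 3 (λ x y z → x :* y :* z := z :* x :* y) refl (u l i) (u l j) (u l k)) ,
    sum-cong {r} (λ l → solve 3 (λ x y z → x :* y :* z := z :* y :* x) refl (u l i) (u l j) (u l k))

  -- With U the matrix of rows `u l`, every M in the span factors as (UᵀD)U with D = diag(a · u_l).
  -- Thus M⁻¹UᵀD is a left inverse of U, which is the form of independence that the column extension
  -- consumes.
  cubes-leftInverse : ∀ (u : Vector (Vector Carrier n) r) →
    (∃[ M ] Span (slices (cubes u)) M × Invertible M) →
    ∃ λ (L : Fin n → Vector Carrier r) → ∀ i j → (L i · λ l → u l j) ≈ 1ᴹ i j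
  cubes-leftInverse {n} {r} u (M , (a , M≈) , M⁻ , M⁻M≈1 , _) = (λ i → M⁻ i ᵛ* A) , λ i j → begin
    (M⁻ i ᵛ* A) · (λ l → u l j)          ≈⟨ ·-assoc (M⁻ i) A (λ l → u l j) ⟩
    M⁻ i · (A *ᵛ λ l → u l j)            ≈⟨ ·-congˡ {n} (λ h → AU≈M h j) ⟩
    (M⁻ *ᴹ M) i j                        ≈⟨ M⁻M≈1 i j ⟩
    1ᴹ i j                               ∎
    where
    A : Fin n → Vector Carrier r
    A h l = (a · u l) * u l h

    AU≈M : ∀ h j → (A *ᵛ λ l → u l j) h ≈ M h j
    AU≈M h j = begin
      sum (λ l → (a · u l) * u l h * u l j)    ≈⟨ sum-cong {r} (λ l → *-assoc (a · u l) (u l h) (u l j)) ⟩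
      sum (λ l → (a · u l) * (u l h * u l j))  ≈⟨ span-cubes u a h j ⟨
      sum (λ k → a k * cubes u h j k)          ≈⟨ M≈ h j ⟨
      M h j                                    ∎

  ᵀ-inverse : ∀ (A B : Matrix n) → A *ᴹ B ≈ᴹ 1ᴹ → B ᵀ *ᴹ A ᵀ ≈ᴹ 1ᴹ
  ᵀ-inverse A B AB≈1 i j = begin
    (λ k → B k i) · A j   ≈⟨ ·-comm (λ k → B k i) (A j) ⟩
    (A *ᴹ B) j i          ≈⟨ AB≈1 j i ⟩
    1ᴹ j i                ≈⟨ 1ᴹ-symmetric ⟩
    1ᴹ i j                ∎
    where
    1ᴹ-symmetric : 1ᴹ j i ≈ 1ᴹ i j
    1ᴹ-symmetric with j Fin.≟ i
    ... | yes ≡.refl = sym (1ᴹ-≡ j)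
    ... | no j≢i     = sym (1ᴹ-≢ (j≢i ∘ ≡.sym))

  -- Entrywise, Y i j * d j is the Kronecker delta. Its diagonal case shows that every d j is
  -- nonzero, and then its other cases kill the entries of Y off the diagonal.
  leftInverse-diagonal : ∀ (Y : Matrix n) d → Y *ᴹ diagonal d ≈ᴹ 1ᴹ → Y ≈ᴹ diagonal (λ m → Y m m)
  leftInverse-diagonal Y d Yd≈1 i j = lemma
    where
    Yd : ∀ i j → Y i j * d j ≈ 1ᴹ i j
    Yd i j = trans (sym (·-diagonal (Y i) d j)) (Yd≈1 i j)

    d≉0 : ¬ (d j ≈ 0#)
    d≉0 d≈0 = 0≉1 (begin
      0#            ≈⟨ zeroʳ (Y j j) ⟨
      Y j j * 0#    ≈⟨ *-congˡ d≈0 ⟨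
      Y j j * d j   ≈⟨ Yd j j ⟩
      1ᴹ j j        ≈⟨ 1ᴹ-≡ j ⟩
      1#            ∎)

    lemma : Y i j ≈ diagonal (λ m → Y m m) i j
    lemma with i Fin.≟ j
    ... | yes ≡.refl = refl
    ... | no i≢j     = *-cancel-≈0 d≉0
      (trans (*-comm (d j) (Y i j)) (trans (Yd i j) (1ᴹ-≢ i≢j)))

  SlicesDiagonalizable : Pred (Tensor n) (c ⊔ ℓ)
  SlicesDiagonalizable S =
    ∀ Z → Span (slices S) Z → (Z-inv : Invertible Z) →
    (∀ i j → Commute (inv Z Z-inv *ᴹ slices S i) (inv Z Z-inv *ᴹ slices S j)) ×
    (∀ i → Diagonalizable (inv Z Z-inv *ᴹ slices S i))

  module _ (V : Matrix n) (V⁻¹ : Invertible V) where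
    private
      Q = inv V V⁻¹
      QV≈1 = proj₁ (proj₂ V⁻¹)
      VQ≈1 = proj₂ (proj₂ V⁻¹)

      S : Tensor n
      S = cubes V

    span-cubes-basis : ∀ Z ((a , _) : Span (slices S) Z) →
      Z ≈ᴹ V ᵀ *ᴹ diagonal (λ l → a · V l) *ᴹ V
    span-cubes-basis Z (a , Z≈) i j = begin
      Z i j                                          ≈⟨ Z≈ i j ⟩
      sum (λ k → a k * S i j k)                      ≈⟨ span-cubes V a i j ⟩
      sum (λ l → (a · V l) * (V l i * V l j))        ≈⟨ sandwich (V ᵀ) V (λ l → a · V l) i j ⟨
      (V ᵀ *ᴹ diagonal (λ l → a · V l) *ᴹ V) i j     ∎

    slices-cubes-basis : ∀ k → slices S k ≈ᴹ V ᵀ *ᴹ diagonal (λ l → V l k) *ᴹ V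
    slices-cubes-basis k i j = begin
      sum (λ l → V l i * V l j * V l k)              ≈⟨ sum-cong {n} (λ l → *-comm (V l i * V l j) (V l k)) ⟩
      sum (λ l → V l k * (V l i * V l j))            ≈⟨ sandwich (V ᵀ) V (λ l → V l k) i j ⟨
      (V ᵀ *ᴹ diagonal (λ l → V l k) *ᴹ V) i j       ∎

    cubes-basis-nondegenerate : ∃[ Z ] Span (slices S) Z × Invertible Z
    cubes-basis-nondegenerate = Z , Z∈span , Q *ᴹ Q ᵀ ,
      M.trans (M.∙-congˡ Z≈VᵀV) (M.congruence-inverse V (V ᵀ) Q (Q ᵀ) QV≈1 (ᵀ-inverse V Q VQ≈1)) ,
      M.trans (M.∙-congʳ (M.trans Z≈VᵀV (M.∙-congʳ (M.identityʳ (V ᵀ)))))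
        (M.trans (M.∙-congˡ (M.∙-congʳ (M.sym (M.identityʳ Q))))
          (M.congruence-inverse (Q ᵀ) Q (V ᵀ) V (ᵀ-inverse Q V QV≈1) VQ≈1))
      where
      -- Chosen so that a · V l = 1 for every l; the diagonal factor becomes the identity and Z =
      -- VᵀV, with inverse QQᵀ.
      a = Q *ᵛ λ _ → 1#

      Z : Matrix n
      Z i j = sum (λ k → a k * S i j k)

      Z∈span : Span (slices S) Z
      Z∈span = a , λ _ _ → refl

      Z≈VᵀV : Z ≈ᴹ V ᵀ *ᴹ 1ᴹ *ᴹ V
      Z≈VᵀV = M.trans (span-cubes-basis Z Z∈span)
        (M.∙-congʳ (M.∙-congˡ (diagonal-cong λ l →
          trans (·-comm a (V l)) (cancel-inverse VQ≈1 (λ _ → 1#) l))))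

    cubes-basis-diagonalizable : SlicesDiagonalizable S
    cubes-basis-diagonalizable Z Z∈span (Z⁻ , Z⁻Z≈1 , _) =
      (λ i j → M.trans (M.∙-cong (Z⁻S≈ i) (Z⁻S≈ j))
        (M.trans (M.conj-commute Q V (D i) (D j) VQ≈1 (diagonal-comm (d i) (d j)))
          (M.sym (M.∙-cong (Z⁻S≈ j) (Z⁻S≈ i))))) ,
      (λ i → Q , d i , (V , VQ≈1 , QV≈1) ,
        M.trans (M.∙-congʳ (M.∙-congˡ (Z⁻S≈ i))) (M.conj-cancel V Q (D i) VQ≈1))
      where
      -- The inverse of the diagonal factor of Z = VᵀDV, read off from the given inverse of Z. Then
      -- Z⁻¹Z_i = Q (Y D_i) V with Y D_i diagonal.
      Y : Matrix n
      Y = V *ᴹ Z⁻ *ᴹ V ᵀ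

      Y-diagonal : Y ≈ᴹ diagonal (λ m → Y m m)
      Y-diagonal = leftInverse-diagonal Y _
        (M.inverse-of-congruence V (V ᵀ) Q Z⁻ _ VQ≈1
          (M.trans (M.∙-congˡ (M.sym (span-cubes-basis Z Z∈span))) Z⁻Z≈1))

      d : Fin n → Vector Carrier n
      d i m = Y m m * V m i

      D : Fin n → Matrix n
      D i = diagonal (d i)

      Z⁻S≈ : ∀ i → Z⁻ *ᴹ slices S i ≈ᴹ Q *ᴹ D i *ᴹ V
      Z⁻S≈ i = M.trans (M.∙-congˡ (slices-cubes-basis i))
        (M.trans (M.insert-inverse V (V ᵀ) Q Z⁻ (diagonal (λ l → V l i)) QV≈1)
          (M.∙-congʳ (M.∙-congˡ (M.trans (M.∙-congʳ Y-diagonal)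
            (diagonal-*-diagonal (λ m → Y m m) (λ l → V l i))))))

  -- From commuting diagonalizable slices to cubes

  ·-scaleˡ : ∀ (x y : Vector Carrier n) a → (λ i → a * x i) · y ≈ a * (x · y)
  ·-scaleˡ x y a = trans (·-comm (λ i → a * x i) y) (trans (·-scale y x a) (*-congˡ (·-comm y x)))

  -- The vanishing 2 × 2 minors say that x and y are parallel. Pairing them with a, normalized by x
  -- · a = 1, gives the factor without choosing a nonzero coordinate of x.
  proportional : ∀ (x y a : Vector Carrier n) → x · a ≈ 1# →
    (∀ j k → x k * y j ≈ x j * y k) → ∀ k → y k ≈ (y · a) * x k
  proportional {n} x y a xa≈1 xy≈yx k = begin
    y k                         ≈⟨ *-identityʳ (y k) ⟨
    y k * 1#                    ≈⟨ *-congˡ xa≈1 ⟨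
    y k * (x · a)               ≈⟨ ·-scaleˡ x a (y k) ⟨
    (λ j → y k * x j) · a       ≈⟨ ·-congʳ {n} (λ j → trans (*-comm (y k) (x j)) (sym (xy≈yx j k))) ⟩
    (λ j → x k * y j) · a       ≈⟨ ·-scaleˡ y a (x k) ⟩
    x k * (y · a)               ≈⟨ *-comm (x k) (y · a) ⟩
    (y · a) * x k               ∎

  -- Writing λ_l for the joint eigenvalues of the matrices Z⁻¹Z_k, the symmetry of
  -- S makes row l of P⁻¹ and column l of ZP proportional to λ_l, so that
  -- Z_k = (ZP) diag(λ_l(k)) P⁻¹ is the expansion of S into multiples of the λ_l^⊗3.
  diagonalizable⇒sumOfCubes : (∀ x → ∃[ y ] y * y * y ≈ x) →
    ∀ (S : Tensor n) → Symmetric S →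
    (∃[ Z ] Span (slices S) Z × Invertible Z) → SlicesDiagonalizable S → SumOfCubes S n
  diagonalizable⇒sumOfCubes {n} cubeRoot S symm (Z , Z∈span@(a , Z≈) , Z-inv@(Z⁻ , Z⁻Z≈1 , ZZ⁻≈1)) diag =
    expansion (commonEigenbasis A (proj₁ (diag Z Z∈span Z-inv)) (proj₂ (diag Z Z∈span Z-inv)))
    where
    A : Vector (Matrix n) n
    A i = Z⁻ *ᴹ slices S i

    -- Left multiplication by Z⁻¹ touches only the first index of S, so the symmetry in the other
    -- two survives.
    A-symmetric : ∀ i j k → A k i j ≈ A j i k
    A-symmetric i j k = ·-congˡ {n} λ h → proj₁ (symm h j k)

    ΣaA≈1 : ∀ i j → (λ k → A k i j) · a ≈ 1ᴹ i j
    ΣaA≈1 i j = begin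
      (Z⁻ i ᵛ* λ h k → S h j k) · a       ≈⟨ ·-assoc (Z⁻ i) (λ h k → S h j k) a ⟩
      (Z⁻ i · λ h → S h j · a)            ≈⟨ ·-congˡ {n} (λ h → trans (·-comm (S h j) a) (sym (Z≈ h j))) ⟩
      (Z⁻ *ᴹ Z) i j                       ≈⟨ Z⁻Z≈1 i j ⟩
      1ᴹ i j                              ∎

    expansion : (∃ λ (P : Matrix n) → Invertible P × ∀ l k → Eigenvector (A k) (λ i → P i l)) →
      SumOfCubes S n
    expansion (P , (Q , QP≈1 , PQ≈1) , eigen) = u , S≈cubes
      where
      Λ : Fin n → Vector Carrier n
      Λ l k = proj₁ (eigen l k)

      D : Fin n → Matrix n
      D k = diagonal λ l → Λ l k

      H : Matrix n
      H = Z *ᴹ P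

      AP≈PD : ∀ k → A k *ᴹ P ≈ᴹ P *ᴹ D k
      AP≈PD k i l = begin
        (A k *ᴹ P) i l     ≈⟨ proj₂ (eigen l k) i ⟩
        Λ l k * P i l      ≈⟨ *-comm (Λ l k) (P i l) ⟩
        P i l * Λ l k      ≈⟨ ·-diagonal (P i) (λ l → Λ l k) l ⟨
        (P *ᴹ D k) i l     ∎

      QA≈ΛQ : ∀ k l j → (Q *ᴹ A k) l j ≈ Λ l k * Q l j
      QA≈ΛQ k l j = trans (M.intertwine P Q (A k) (D k) PQ≈1 QP≈1 (AP≈PD k) l j)
        (diagonal-· (λ l → Λ l k) (λ m → Q m j) l)

      -- Rows of Q are left eigenvectors of every A k; exchanging j and k in A turns this into the
      -- vanishing minors of row l of Q against Λ l.
      Q-exchange : ∀ l j k → Λ l k * Q l j ≈ Λ l j * Q l k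
      Q-exchange l j k = begin
        Λ l k * Q l j      ≈⟨ QA≈ΛQ k l j ⟨
        (Q *ᴹ A k) l j     ≈⟨ ·-congˡ {n} (λ i → A-symmetric i j k) ⟩
        (Q *ᴹ A j) l k     ≈⟨ QA≈ΛQ j l k ⟩
        Λ l j * Q l k      ∎

      [Λa]Q≈Q : ∀ l j → (Λ l · a) * Q l j ≈ Q l j
      [Λa]Q≈Q l j = begin
        (Λ l · a) * Q l j                  ≈⟨ *-comm (Λ l · a) (Q l j) ⟩
        Q l j * (Λ l · a)                  ≈⟨ ·-scaleˡ (Λ l) a (Q l j) ⟨
        (λ k → Q l j * Λ l k) · a          ≈⟨ ·-congʳ {n} (λ k → trans (*-comm (Q l j) (Λ l k)) (sym (QA≈ΛQ k l j))) ⟩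
        (Q l ᵛ* λ i k → A k i j) · a       ≈⟨ ·-assoc (Q l) (λ i k → A k i j) a ⟩
        (Q l · λ i → (λ k → A k i j) · a)  ≈⟨ ·-congˡ {n} (λ i → ΣaA≈1 i j) ⟩
        (Q l · λ i → 1ᴹ i j)               ≈⟨ ·-1ᴹ (Q l) j ⟩
        Q l j                              ∎

      -- The character Λ l sends the unit a to 1. Since the a-combination of the A k is the
      -- identity, Λ l · a fixes row l of Q, and pairing that row with column l of P cancels it.
      Λa≈1 : ∀ l → Λ l · a ≈ 1#
      Λa≈1 l = begin
        Λ l · a                                    ≈⟨ *-identityʳ (Λ l · a) ⟨
        (Λ l · a) * 1#                             ≈⟨ *-congˡ QP≈1ₗ ⟨
        (Λ l · a) * (Q *ᴹ P) l l                   ≈⟨ ·-scaleˡ (Q l) (λ i → P i l) (Λ l · a) ⟨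
        ((λ j → (Λ l · a) * Q l j) · λ i → P i l)  ≈⟨ ·-congʳ {n} ([Λa]Q≈Q l) ⟩
        (Q *ᴹ P) l l                               ≈⟨ QP≈1ₗ ⟩
        1#                                         ∎
        where QP≈1ₗ = trans (QP≈1 l l) (1ᴹ-≡ l)

      ZA≈S : ∀ k → Z *ᴹ A k ≈ᴹ slices S k
      ZA≈S k = M.trans (M.sym (M.assoc Z Z⁻ (slices S k)))
        (M.trans (M.∙-congʳ ZZ⁻≈1) (M.identityˡ (slices S k)))

      SP≈HD : ∀ k → slices S k *ᴹ P ≈ᴹ H *ᴹ D k
      SP≈HD k = M.trans (M.∙-congʳ (M.sym (ZA≈S k))) (M.trans (M.assoc Z (A k) P)
        (M.trans (M.∙-congˡ (AP≈PD k)) (M.sym (M.assoc Z P (D k)))))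

      S≈HDQ : ∀ k → slices S k ≈ᴹ H *ᴹ D k *ᴹ Q
      S≈HDQ k = M.trans (M.sym (M.identityʳ (slices S k))) (M.trans (M.∙-congˡ (M.sym PQ≈1))
        (M.trans (M.sym (M.assoc (slices S k) P Q)) (M.∙-congʳ (SP≈HD k))))

      -- The same argument on the other side, with the symmetry S i j k = S k j i exchanging the
      -- slice index with the row index.
      H-exchange : ∀ l i k → Λ l k * H i l ≈ Λ l i * H k l
      H-exchange l i k = begin
        Λ l k * H i l              ≈⟨ HD≈ΛH k i ⟨
        (H *ᴹ D k) i l             ≈⟨ SP≈HD k i l ⟨
        (slices S k *ᴹ P) i l      ≈⟨ ·-congʳ {n} (λ j → proj₂ (proj₂ (proj₂ (proj₂ (symm i j k))))) ⟩
        (slices S i *ᴹ P) k l      ≈⟨ SP≈HD i k l ⟩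
        (H *ᴹ D i) k l             ≈⟨ HD≈ΛH i k ⟩
        Λ l i * H k l              ∎
        where
        HD≈ΛH : ∀ k i → (H *ᴹ D k) i l ≈ Λ l k * H i l
        HD≈ΛH k i = trans (·-diagonal (H i) (λ l → Λ l k) l) (*-comm (H i l) (Λ l k))

      μ ν γ : Vector Carrier n
      μ l = Q l · a
      ν l = (λ i → H i l) · a
      γ l = proj₁ (cubeRoot (μ l * ν l))

      u : Vector (Vector Carrier n) n
      u l i = γ l * Λ l i

      S≈cubes : ∀ i j k → S i j k ≈ cubes u i j k
      S≈cubes i j k = trans (S≈HDQ k i j) (trans (sandwich H Q (λ l → Λ l k) i j)
        (sum-cong {n} λ l → begin
          Λ l k * (H i l * Q l j)
            ≈⟨ *-congˡ (*-cong (proportional (Λ l) (λ i → H i l) a (Λa≈1 l) (H-exchange l) i)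
                               (proportional (Λ l) (Q l) a (Λa≈1 l) (Q-exchange l) j)) ⟩
          Λ l k * ((ν l * Λ l i) * (μ l * Λ l j))
            ≈⟨ solve 5 (λ x y z μ ν → z :* ((ν :* x) :* (μ :* y)) := μ :* ν :* (x :* y :* z))
                 refl (Λ l i) (Λ l j) (Λ l k) (μ l) (ν l) ⟩
          μ l * ν l * (Λ l i * Λ l j * Λ l k)
            ≈⟨ *-congʳ (proj₂ (cubeRoot (μ l * ν l))) ⟨
          γ l * γ l * γ l * (Λ l i * Λ l j * Λ l k)
            ≈⟨ solve 4 (λ x y z g → g :* g :* g :* (x :* y :* z) := (g :* x) :* (g :* y) :* (g :* z))
                 refl (Λ l i) (Λ l j) (Λ l k) (γ l) ⟩
          (u l ^⊗3) i j k ∎))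

  -- Symmetric rank as a minimum, and the equivalence

  sumOfCubes-suc : ∀ {T : Tensor n} → SumOfCubes T r → SumOfCubes T (suc r)
  sumOfCubes-suc (u , T≈) =
    (λ { zero _ → 0# ; (suc l) → u l }) , λ i j k → trans (T≈ i j k)
      (sym (trans (+-congʳ (zeroʳ (0# * 0#))) (+-identityˡ (cubes u i j k))))

  sumOfCubes-mono : ∀ {T : Tensor n} → m ℕ.≤′ r → SumOfCubes T m → SumOfCubes T r
  sumOfCubes-mono ℕ.≤′-refl        T≈ = T≈
  sumOfCubes-mono {T = T} (ℕ.≤′-step m≤r) T≈ = sumOfCubes-suc {T = T} (sumOfCubes-mono {T = T} m≤r T≈)

  -- Strong induction: a witness below r is handed to the induction hypothesis, and if there is
  -- none, r itself is least. Deciding P makes the bounded search possible.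
  least-below : ∀ {p} {P : Pred ℕ p} → (∀ k → Dec (P k)) →
    ∀ r → P r → ∃[ m ] IsLeast P m × m ℕ.≤ r
  least-below {P = P} P? = <-rec (λ r → P r → ∃[ m ] IsLeast P m × m ℕ.≤ r) λ r smaller Pr →
    case ℕ.anyUpTo? P? r of λ
      { (yes (k , k<r , Pk)) → let m , least , m≤k = smaller k<r Pk
                               in m , least , ℕ.≤-trans m≤k (ℕ.<⇒≤ k<r)
      ; (no none)            → r , (Pr , λ k Pk → ℕ.≮⇒≥ λ k<r → none (k , k<r , Pk)) , ℕ.≤-refl
      }

  module _ (cubeRoot : ∀ x → ∃[ y ] y * y * y ≈ x)
    (sumOfCubes? : ∀ {n} (T : Tensor n) r → Dec (SumOfCubes T r)) where

    sumOfCubes⇔srank≤ : ∀ (T : Tensor n) r → SRank≤ T r ⇔ SumOfCubes T r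
    sumOfCubes⇔srank≤ T r = mk⇔
      (λ (m , (T≈ , _) , m≤r) → sumOfCubes-mono {T = T} (ℕ.≤⇒≤′ m≤r) T≈)
      (least-below (sumOfCubes? T) r)

    srank-characterization : ∀ (T : Tensor n) →
      (∃[ M ] Span (slices T) M × Invertible M) → ∀ r (n≤r : n ℕ.≤ r) →
      SRank≤ T r ⇔
      (∃ λ (S : Tensor r) → Symmetric S × (∃[ Z ] Span (slices S) Z × Invertible Z) ×
        SlicesDiagonalizable S × Subtensor n≤r T S)
    srank-characterization {n} T (M , (a , M≈) , M⁻¹) r n≤r = mk⇔
      (λ srank≤r → extend (Equivalence.to (sumOfCubes⇔srank≤ T r) srank≤r))
      (λ (S , symm , nondeg , diag , T⊂S) → Equivalence.from (sumOfCubes⇔srank≤ T r)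
        (restrict S T⊂S (diagonalizable⇒sumOfCubes cubeRoot S symm nondeg diag)))
      where
      extend : SumOfCubes T r → _
      extend (u , T≈) =
        -- The invertible matrix in the span of the slices of T is carried over to the slices of
        -- `cubes u` along `T≈`.
        let L , LU≈1 = cubes-leftInverse u
              (M , (a , λ i j → trans (M≈ i j) (sum-cong {n} λ k → *-congˡ (T≈ i j k))) , M⁻¹)
            V , V⁻¹ , V⊃u = extendColumns n≤r u L LU≈1
        in cubes V , cubes-symmetric V , cubes-basis-nondegenerate V V⁻¹ ,
           cubes-basis-diagonalizable V V⁻¹ ,
           λ i j k → trans (T≈ i j k) (sum-cong {r} λ l →
             sym (*-cong (*-cong (V⊃u i l) (V⊃u j l)) (V⊃u k l)))

      restrict : ∀ S → Subtensor n≤r T S → SumOfCubes S r → SumOfCubes T r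
      restrict S T⊂S (u , S≈) =
        (λ l i → u l (inject≤ i n≤r)) , λ i j k → trans (T⊂S i j k) (S≈ _ _ _)

-- Intermediate values and roots over the reals

module RealRoots {c ℓ₁ ℓ₂} (ℝ : CompleteOrderedField c ℓ₁ ℓ₂)
  (_≈?_ : Decidable (CompleteOrderedField._≈_ ℝ)) where

  open CompleteOrderedField ℝ
  open IntegerSolver commutativeRing
  open Relation.Binary.Reasoning.Setoid setoid
  open IsTotalOrder isTotalOrder using (antisym; total; ≤-respʳ-≈; ≤-respˡ-≈)
    renaming (trans to ≤-trans; reflexive to ≤-reflexive)

  decidableField : DecidableField commutativeRing
  decidableField = record { _≈?_ = _≈?_ ; 0≉1 = 0≉1 ; inverse = inverse }

  open LinearAlgebra commutativeRing decidableField using (*-cancel-≈0)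

  ≤-gap : ∀ {x y e} → 0# ≤ e → y ≈ x + e → x ≤ y
  ≤-gap {x} {y} {e} 0≤e y≈x+e = ≤-respˡ-≈ (+-identityʳ x) (≤-respʳ-≈ (sym y≈x+e) (+-monoʳ-≤ x 0≤e))

  gap-nonNeg : ∀ {x y} → x ≤ y → 0# ≤ y - x
  gap-nonNeg {x} {y} x≤y = ≤-respˡ-≈ (-‿inverseˡ x) (≤-respʳ-≈ (+-comm (- x) y) (+-monoʳ-≤ (- x) x≤y))

  +-nonNeg : ∀ {x y} → 0# ≤ x → 0# ≤ y → 0# ≤ x + y
  +-nonNeg {x} 0≤x 0≤y = ≤-trans 0≤x (≤-gap 0≤y refl)

  neg-nonNeg : ∀ {x} → x ≤ 0# → 0# ≤ - x
  neg-nonNeg {x} x≤0 = ≤-respʳ-≈ (+-identityˡ (- x)) (gap-nonNeg x≤0)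

  square-nonNeg : ∀ x → 0# ≤ x * x
  square-nonNeg x with total 0# x
  ... | inj₁ 0≤x = *-nonNeg 0≤x 0≤x
  ... | inj₂ x≤0 = ≤-respʳ-≈ (solve 1 (λ x → :- x :* :- x := x :* x) refl x)
                     (*-nonNeg (neg-nonNeg x≤0) (neg-nonNeg x≤0))

  0≤1 : 0# ≤ 1#
  0≤1 = ≤-respʳ-≈ (*-identityˡ 1#) (square-nonNeg 1#)

  *-zero-product : ∀ {x y} → x * y ≈ 0# → x ≈ 0# ⊎ y ≈ 0#
  *-zero-product {x} xy≈0 with x ≈? 0#
  ... | yes x≈0 = inj₁ x≈0
  ... | no x≉0  = inj₂ (*-cancel-≈0 x≉0 xy≈0)

  square-zero : ∀ {x} → x * x ≈ 0# → x ≈ 0#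
  square-zero x²≈0 = [ (λ x≈0 → x≈0) , (λ x≈0 → x≈0) ]′ (*-zero-product x²≈0)

  sumOfSquares-zeroˡ : ∀ {x y} → x * x + y * y ≈ 0# → x ≈ 0#
  sumOfSquares-zeroˡ {x} {y} eq = square-zero
    (antisym (≤-gap (square-nonNeg y) (sym eq)) (square-nonNeg x))

  -- If y ≤ x, then (x - y)² is minus the sum of y² - x² and 2y(x - y), both nonnegative, so x = y.
  square-≤ : ∀ {x y} → 0# ≤ y → 0# ≤ y * y - x * x → x ≤ y
  square-≤ {x} {y} 0≤y 0≤y²-x² with total x y
  ... | inj₁ x≤y = x≤y
  ... | inj₂ y≤x = ≤-reflexive (begin
    x              ≈⟨ solve 2 (λ x y → x := x :- y :+ y) refl x y ⟩
    x - y + y      ≈⟨ +-congʳ (square-zero (antisym [x-y]²≤0 (square-nonNeg (x - y)))) ⟩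
    0# + y         ≈⟨ +-identityˡ y ⟩
    y              ∎)
    where
    [x-y]²≤0 : (x - y) * (x - y) ≤ 0#
    [x-y]²≤0 = ≤-gap (+-nonNeg 0≤y²-x² (*-nonNeg (+-nonNeg 0≤y 0≤y) (gap-nonNeg y≤x)))
      (solve 2 (λ x y → con 0ℤ := (x :- y) :* (x :- y) :+
        (y :* y :- x :* x :+ (y :+ y) :* (x :- y))) refl x y)

  -- The supremum of { x ∈ [p , q] | f x ≤ 0 } is a zero: otherwise the slope bound
  -- would produce a larger element of the set or a smaller upper bound.
  intermediateValue : ∀ (f : Carrier → Carrier) p q L → p ≤ q → 1# ≤ L →
    (∀ x y → p ≤ x → x ≤ y → y ≤ q → f y - f x ≤ L * (y - x)) →
    f p ≤ 0# → 0# ≤ f q → ∃[ s ] p ≤ s × s ≤ q × f s ≈ 0#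
  intermediateValue f p q L p≤q 1≤L slope fp≤0 0≤fq = s , p≤s , s≤q , fs≈0
    where
    P : Pred Carrier (c ⊔ ℓ₁ ⊔ ℓ₂)
    -- `supremum` accepts predicates at one fixed level, hence the lift.
    P x = Lift (c ⊔ ℓ₁) (p ≤ x × x ≤ q × f x ≤ 0#)

    p∈P : P p
    p∈P = lift (p≤p , p≤q , fp≤0)
      where p≤p = ≤-reflexive refl

    q-bound : UpperBound P q
    q-bound x (lift (_ , x≤q , _)) = x≤q

    sup = supremum P (p , p∈P) (q , q-bound)
    s = proj₁ sup

    s-bound : UpperBound P s
    s-bound = proj₁ (proj₂ sup)

    s-least : ∀ b → UpperBound P b → s ≤ b
    s-least = proj₂ (proj₂ sup)

    p≤s : p ≤ s
    p≤s = s-bound p p∈P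

    s≤q : s ≤ q
    s≤q = s-least q q-bound

    0≤L : 0# ≤ L
    0≤L = ≤-trans 0≤1 1≤L

    L≉0 : ¬ (L ≈ 0#)
    L≉0 L≈0 = 0≉1 (antisym 0≤1 (≤-respʳ-≈ L≈0 1≤L))

    M = proj₁ (inverse L L≉0)

    LM≈1 : L * M ≈ 1#
    LM≈1 = proj₂ (inverse L L≉0)

    0≤M : 0# ≤ M
    0≤M = ≤-respʳ-≈ (begin
      L * (M * M)  ≈⟨ *-assoc L M M ⟨
      L * M * M    ≈⟨ *-congʳ LM≈1 ⟩
      1# * M       ≈⟨ *-identityˡ M ⟩
      M            ∎) (*-nonNeg 0≤L (square-nonNeg M))

    L[Mx]≈x : ∀ x → L * (M * x) ≈ x
    L[Mx]≈x x = trans (sym (*-assoc L M x)) (trans (*-congʳ LM≈1) (*-identityˡ x))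

    M*-zero : ∀ x → 0# ≤ x → M * x ≤ 0# → x ≈ 0#
    M*-zero x 0≤x Mx≤0 = begin
      x              ≈⟨ L[Mx]≈x x ⟨
      L * (M * x)    ≈⟨ *-congˡ (antisym Mx≤0 (*-nonNeg 0≤M 0≤x)) ⟩
      L * 0#         ≈⟨ zeroʳ L ⟩
      0#             ∎

    +-cancel-≤ : ∀ {x e} → x + e ≤ x → e ≤ 0#
    +-cancel-≤ {x} {e} x+e≤x = ≤-gap (gap-nonNeg x+e≤x)
      (solve 2 (λ x e → con 0ℤ := e :+ (x :- (x :+ e))) refl x e)

    -- By the slope bound f cannot become positive before s - f s / L. Either that point lies in the
    -- interval, hence in P and below s, so the step is zero; or q does, so q ≤ s and f q ≤ f s.
    module Negative (fs≤0 : f s ≤ 0#) where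
      step = M * (- f s)

      y = s + step

      0≤step : 0# ≤ step
      0≤step = *-nonNeg 0≤M (neg-nonNeg fs≤0)

      f≤0-upto-y : ∀ z → s ≤ z → z ≤ q → z ≤ y → f z ≤ 0#
      f≤0-upto-y z s≤z z≤q z≤y = ≤-gap
        (+-nonNeg (gap-nonNeg (slope s z p≤s s≤z z≤q)) (*-nonNeg 0≤L (gap-nonNeg z≤y))) (begin
          0#                                ≈⟨ -‿inverseʳ (f s) ⟨
          f s - f s                         ≈⟨ +-congˡ (L[Mx]≈x (- f s)) ⟨
          f s + L * step                    ≈⟨ solve 6 (λ fs fz L d s z →
            fs :+ L :* d := fz :+ ((L :* (z :- s) :- (fz :- fs)) :+ L :* (s :+ d :- z)))
            refl (f s) (f z) L step s z ⟩
          f z + ((L * (z - s) - (f z - f s)) + L * (y - z)) ∎)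

      fs≈0 : f s ≈ 0#
      fs≈0 with total y q
      ... | inj₁ y≤q = begin
        f s      ≈⟨ solve 1 (λ x → x := :- (:- x)) refl (f s) ⟩
        - - f s  ≈⟨ -‿cong (M*-zero (- f s) (neg-nonNeg fs≤0) (+-cancel-≤ (s-bound y y∈P))) ⟩
        - 0#     ≈⟨ solve 0 (:- con 0ℤ := con 0ℤ) refl ⟩
        0#       ∎
        where
        s≤y = ≤-gap 0≤step refl
        y∈P = lift (≤-trans p≤s s≤y , y≤q , f≤0-upto-y y s≤y y≤q (≤-reflexive refl))
      ... | inj₂ q≤y = antisym fs≤0 (≤-trans 0≤fq fq≤fs)
        where
        q≤s : q ≤ s
        q≤s = s-bound q (lift (p≤q , ≤-reflexive refl , f≤0-upto-y q s≤q (≤-reflexive refl) q≤y))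

        fq≤fs : f q ≤ f s
        fq≤fs = ≤-gap (+-nonNeg (gap-nonNeg (slope s q p≤s s≤q (≤-reflexive refl)))
            (*-nonNeg 0≤L (gap-nonNeg q≤s)))
          (solve 5 (λ fs fq L s q → fs := fq :+ ((L :* (q :- s) :- (fq :- fs)) :+ L :* (s :- q)))
            refl (f s) (f q) L s q)

    -- For x in P the slope bound gives f s ≤ L (s - x), so s - f s / L already bounds P and
    -- leastness of s leaves no room for the decrement.
    module Positive (0≤fs : 0# ≤ f s) where
      t = s + - (M * f s)

      t-bound : UpperBound P t
      t-bound x x∈P@(lift (p≤x , x≤q , fx≤0)) = ≤-gap (*-nonNeg 0≤M
        (+-nonNeg (gap-nonNeg (slope x s p≤x (s-bound x x∈P) s≤q)) (neg-nonNeg fx≤0))) (begin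
          s - M * f s                                   ≈⟨ solve 4 (λ s M fs x →
            s :- M :* fs := x :+ (con 1ℤ :* (s :- x) :- M :* fs)) refl s M (f s) x ⟩
          x + (1# * (s - x) - M * f s)                  ≈⟨ +-congˡ (+-congʳ (*-congʳ LM≈1)) ⟨
          x + (L * M * (s - x) - M * f s)               ≈⟨ solve 6 (λ s M fs x fx L →
            x :+ (L :* M :* (s :- x) :- M :* fs) :=
            x :+ M :* ((L :* (s :- x) :- (fs :- fx)) :+ :- fx)) refl s M (f s) x (f x) L ⟩
          x + M * ((L * (s - x) - (f s - f x)) + - f x) ∎)

      fs≈0 : f s ≈ 0#
      fs≈0 = M*-zero (f s) 0≤fs (≤-gap (gap-nonNeg (s-least t t-bound))
        (solve 2 (λ s d → con 0ℤ := d :+ (s :+ :- d :- s)) refl s (M * f s)))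

    fs≈0 : f s ≈ 0#
    fs≈0 = [ Negative.fs≈0 , Positive.fs≈0 ]′ (total (f s) 0#)

  -- The difference quotient is presented as L - e with an explicit nonnegative e, so that the ring
  -- solver can check each concrete slope estimate.
  slope-bound : ∀ {fx fy x y L e} → x ≤ y → 0# ≤ e → fy - fx ≈ (y - x) * (L - e) →
    fy - fx ≤ L * (y - x)
  slope-bound {fx} {fy} {x} {y} {L} {e} x≤y 0≤e eq = ≤-gap (*-nonNeg (gap-nonNeg x≤y) 0≤e) (begin
    L * (y - x)                        ≈⟨ solve 4 (λ x y L e →
      L :* (y :- x) := (y :- x) :* (L :- e) :+ (y :- x) :* e) refl x y L e ⟩
    (y - x) * (L - e) + (y - x) * e    ≈⟨ +-congʳ eq ⟨
    fy - fx + (y - x) * e              ∎)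

  zero⇒≈ : ∀ {x y} → x - y ≈ 0# → x ≈ y
  zero⇒≈ {x} {y} x-y≈0 = begin
    x          ≈⟨ solve 2 (λ x y → x := x :- y :+ y) refl x y ⟩
    x - y + y  ≈⟨ +-congʳ x-y≈0 ⟩
    0# + y     ≈⟨ +-identityˡ y ⟩
    y          ∎

  squareRoot : ∀ a → 0# ≤ a → ∃[ x ] 0# ≤ x × x * x ≈ a
  squareRoot a 0≤a =
    let x , 0≤x , _ , fx≈0 = intermediateValue f 0# q L 0≤q 1≤L slope f0≤0 0≤fq
    in x , 0≤x , zero⇒≈ fx≈0
    where
    f : Carrier → Carrier
    f x = x * x - a

    -- At q the value is 1 + a + a², which is nonnegative. The difference quotient x + y is at most
    -- 2q, and the extra 1 in L makes L invertible.
    q = 1# + a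
    L = 1# + (q + q)

    0≤q : 0# ≤ q
    0≤q = +-nonNeg 0≤1 0≤a

    1≤L : 1# ≤ L
    1≤L = ≤-gap (+-nonNeg 0≤q 0≤q) refl

    slope : ∀ x y → 0# ≤ x → x ≤ y → y ≤ q → f y - f x ≤ L * (y - x)
    slope x y 0≤x x≤y y≤q = slope-bound x≤y
      (+-nonNeg 0≤1 (+-nonNeg (gap-nonNeg (≤-trans x≤y y≤q)) (gap-nonNeg y≤q)))
      (solve 4 (λ x y a q → (y :* y :- a) :- (x :* x :- a) :=
        (y :- x) :* (con 1ℤ :+ (q :+ q) :- (con 1ℤ :+ (q :- x :+ (q :- y))))) refl x y a q)

    f0≤0 : f 0# ≤ 0#
    f0≤0 = ≤-gap 0≤a (solve 1 (λ a → con 0ℤ := con 0ℤ :* con 0ℤ :- a :+ a) refl a)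

    0≤fq : 0# ≤ f q
    0≤fq = ≤-respʳ-≈
      (solve 1 (λ a → con 1ℤ :+ a :+ a :* a := (con 1ℤ :+ a) :* (con 1ℤ :+ a) :- a) refl a)
      (+-nonNeg 0≤q (square-nonNeg a))

  nonNegCubeRoot : ∀ a → 0# ≤ a → ∃[ x ] 0# ≤ x × x * x * x ≈ a
  nonNegCubeRoot a 0≤a =
    let x , 0≤x , _ , fx≈0 = intermediateValue f 0# q L 0≤q 1≤L slope f0≤0 0≤fq
    in x , 0≤x , zero⇒≈ fx≈0
    where
    f : Carrier → Carrier
    f x = x * x * x - a

    q = 1# + a
    -- The difference quotient x² + xy + y² is at most 3q² on the interval.
    L = 1# + (q * q + q * q + q * q)

    0≤q : 0# ≤ q
    0≤q = +-nonNeg 0≤1 0≤a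

    1≤L : 1# ≤ L
    1≤L = ≤-gap (+-nonNeg (+-nonNeg (square-nonNeg q) (square-nonNeg q)) (square-nonNeg q)) refl

    slope : ∀ x y → 0# ≤ x → x ≤ y → y ≤ q → f y - f x ≤ L * (y - x)
    slope x y 0≤x x≤y y≤q = slope-bound x≤y
      (+-nonNeg 0≤1 (+-nonNeg (+-nonNeg
        (*-nonNeg (gap-nonNeg x≤q) (+-nonNeg 0≤q 0≤x))
        (*-nonNeg (gap-nonNeg y≤q) (+-nonNeg 0≤q 0≤y)))
        (+-nonNeg (*-nonNeg (gap-nonNeg x≤q) 0≤q) (*-nonNeg 0≤x (gap-nonNeg y≤q)))))
      (solve 4 (λ x y a q → (y :* y :* y :- a) :- (x :* x :* x :- a) :=
        (y :- x) :* (con 1ℤ :+ (q :* q :+ q :* q :+ q :* q) :-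
          (con 1ℤ :+ ((q :- x) :* (q :+ x) :+ (q :- y) :* (q :+ y) :+
            ((q :- x) :* q :+ x :* (q :- y)))))) refl x y a q)
      where
      x≤q = ≤-trans x≤y y≤q
      0≤y = ≤-trans 0≤x x≤y

    f0≤0 : f 0# ≤ 0#
    f0≤0 = ≤-gap 0≤a (solve 1 (λ a → con 0ℤ := con 0ℤ :* con 0ℤ :* con 0ℤ :- a :+ a) refl a)

    0≤fq : 0# ≤ f q
    0≤fq = ≤-respʳ-≈
      (solve 1 (λ a → con 1ℤ :+ a :+ a :+ (a :* a :+ a :* a :+ a :* a) :+ a :* (a :* a) :=
        (con 1ℤ :+ a) :* (con 1ℤ :+ a) :* (con 1ℤ :+ a) :- a) refl a)
      (+-nonNeg (+-nonNeg (+-nonNeg 0≤q 0≤a)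
        (+-nonNeg (+-nonNeg 0≤a² 0≤a²) 0≤a²)) (*-nonNeg 0≤a 0≤a²))
      where 0≤a² = square-nonNeg a

  cubeRoot : ∀ a → ∃[ x ] x * x * x ≈ a
  cubeRoot a with total 0# a
  ... | inj₁ 0≤a = let x , _ , x³≈a = nonNegCubeRoot a 0≤a in x , x³≈a
  ... | inj₂ a≤0 = let x , _ , x³≈-a = nonNegCubeRoot (- a) (neg-nonNeg a≤0) in - x , (begin
    - x * - x * - x  ≈⟨ solve 1 (λ x → :- x :* :- x :* :- x := :- (x :* x :* x)) refl x ⟩
    - (x * x * x)    ≈⟨ -‿cong x³≈-a ⟩
    - - a            ≈⟨ solve 1 (λ x → :- (:- x) := x) refl a ⟩
    a                ∎)

  3* : Carrier → Carrier
  3* x = x + x + x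

  -- x³ - 3(ρ² - x²)x = a is the triple-angle equation for the real part of a cube root
  -- of modulus ρ of a complex number with real part a and modulus ρ³.
  trisection : ∀ a ρ → 0# ≤ ρ → - (ρ * ρ * ρ) ≤ a → a ≤ ρ * ρ * ρ →
    ∃[ x ] 0# ≤ ρ * ρ - x * x × x * x * x - 3* ((ρ * ρ - x * x) * x) ≈ a
  trisection a ρ 0≤ρ -ρ³≤a a≤ρ³ =
    let x , -ρ≤x , x≤ρ , fx≈0 = intermediateValue f (- ρ) ρ L -ρ≤ρ 1≤L slope f[-ρ]≤0 0≤fρ
    in x , square-gap x -ρ≤x x≤ρ , zero⇒≈ fx≈0
    where
    f : Carrier → Carrier
    f x = x * x * x - 3* ((ρ * ρ - x * x) * x) - a

    6* : Carrier → Carrier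
    6* x = 3* x + 3* x

    3*-nonNeg : ∀ {x} → 0# ≤ x → 0# ≤ 3* x
    3*-nonNeg 0≤x = +-nonNeg (+-nonNeg 0≤x 0≤x) 0≤x

    6*-nonNeg : ∀ {x} → 0# ≤ x → 0# ≤ 6* x
    6*-nonNeg 0≤x = +-nonNeg (3*-nonNeg 0≤x) (3*-nonNeg 0≤x)

    -- Up to a constant, f is 4x³ - 3ρ²x, with difference quotient 4(x² + xy + y²) - 3ρ², at most
    -- 12ρ² on the interval.
    L = 1# + (6* (ρ * ρ) + 6* (ρ * ρ))

    0≤ρ² = square-nonNeg ρ

    1≤L : 1# ≤ L
    1≤L = ≤-gap (+-nonNeg (6*-nonNeg 0≤ρ²) (6*-nonNeg 0≤ρ²)) refl

    -ρ≤ρ : - ρ ≤ ρ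
    -ρ≤ρ = ≤-gap (+-nonNeg 0≤ρ 0≤ρ) (solve 1 (λ x → x := :- x :+ (x :+ x)) refl ρ)

    square-gap : ∀ x → - ρ ≤ x → x ≤ ρ → 0# ≤ ρ * ρ - x * x
    square-gap x -ρ≤x x≤ρ = ≤-respʳ-≈
      (solve 2 (λ x ρ → (ρ :- x) :* (x :- :- ρ) := ρ :* ρ :- x :* x) refl x ρ)
      (*-nonNeg (gap-nonNeg x≤ρ) (gap-nonNeg -ρ≤x))

    slope : ∀ x y → - ρ ≤ x → x ≤ y → y ≤ ρ → f y - f x ≤ L * (y - x)
    slope x y -ρ≤x x≤y y≤ρ = slope-bound x≤y
      (+-nonNeg (+-nonNeg 0≤1 (3*-nonNeg 0≤ρ²))
        (+-nonNeg (+-nonNeg (6*-nonNeg (square-gap x -ρ≤x (≤-trans x≤y y≤ρ)))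
                            (6*-nonNeg (square-gap y (≤-trans -ρ≤x x≤y) y≤ρ)))
                  (+-nonNeg (square-nonNeg (x - y)) (square-nonNeg (x - y)))))
      (solve 4 (λ x y a ρ →
        let 3* = λ x → x :+ x :+ x
            6* = λ x → 3* x :+ 3* x
            f = λ x → x :* x :* x :- 3* ((ρ :* ρ :- x :* x) :* x) :- a
        in f y :- f x := (y :- x) :* (con 1ℤ :+ (6* (ρ :* ρ) :+ 6* (ρ :* ρ)) :-
             (con 1ℤ :+ 3* (ρ :* ρ) :+
               (6* (ρ :* ρ :- x :* x) :+ 6* (ρ :* ρ :- y :* y) :+
                 ((x :- y) :* (x :- y) :+ (x :- y) :* (x :- y)))))) refl x y a ρ)

    f[-ρ]≤0 : f (- ρ) ≤ 0#
    f[-ρ]≤0 = ≤-gap (gap-nonNeg -ρ³≤a)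
      (solve 2 (λ a ρ →
        let 3* = λ x → x :+ x :+ x
            x = :- ρ
        in con 0ℤ := x :* x :* x :- 3* ((ρ :* ρ :- x :* x) :* x) :- a :+ (a :- :- (ρ :* ρ :* ρ)))
        refl a ρ)

    0≤fρ : 0# ≤ f ρ
    0≤fρ = ≤-respʳ-≈
      (solve 2 (λ a x →
        let 3* = λ x → x :+ x :+ x
        in x :* x :* x :- a := x :* x :* x :- 3* ((x :* x :- x :* x) :* x) :- a) refl a ρ)
      (gap-nonNeg a≤ρ³)

-- Inverses and cube roots over the complex numbers

module ComplexRoots {c ℓ₁ ℓ₂} (ℝ : CompleteOrderedField c ℓ₁ ℓ₂)
  (_≈?_ : Decidable (CompleteOrderedField._≈_ ℝ)) where

  open CompleteOrderedField ℝ
  open IntegerSolver commutativeRing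
  open RealRoots ℝ _≈?_
  open Relation.Binary.Reasoning.Setoid setoid

  private
    ℂ = Complexification.complexification commutativeRing
    module ℂ = CommutativeRing ℂ

  inverseᶜ : ∀ z → ¬ (z ℂ.≈ ℂ.0#) → ∃[ w ] z ℂ.* w ℂ.≈ ℂ.1#
  inverseᶜ (a , b) z≉0 =
    (a * N⁻¹ , - (b * N⁻¹)) ,
    trans (solve 3 (λ a b n →
      a :* (a :* n) :- b :* :- (b :* n) := (a :* a :+ b :* b) :* n) refl a b N⁻¹) NN⁻¹≈1 ,
    solve 3 (λ a b n → a :* :- (b :* n) :+ b :* (a :* n) := con 0ℤ) refl a b N⁻¹
    where
    N = a * a + b * b

    N≉0 : ¬ (N ≈ 0#)
    N≉0 N≈0 = z≉0 (sumOfSquares-zeroˡ N≈0 , sumOfSquares-zeroˡ (trans (+-comm (b * b) (a * a)) N≈0))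

    N⁻¹ = proj₁ (inverse N N≉0)
    NN⁻¹≈1 = proj₂ (inverse N N≉0)

  decidableFieldᶜ : DecidableField ℂ
  decidableFieldᶜ = record
    { _≈?_    = λ (a , b) (x , y) → (a ≈? x) ×-dec (b ≈? y)
    ; 0≉1     = λ (0≈1 , _) → 0≉1 0≈1
    ; inverse = inverseᶜ
    }

  -- Take ρ with ρ⁶ = |z|², and x + ti of modulus ρ whose cube has real part a. Equal moduli leave
  -- only the sign of the imaginary part open, and conjugating the root corrects it.
  cubeRootᶜ : ∀ z → ∃[ w ] w ℂ.* w ℂ.* w ℂ.≈ z
  cubeRootᶜ (a , b) =
    -- σ is the cube root of |z|² and ρ its square root, so ρ³ = |z| is reached without first
    -- forming |z|.
    let σ , 0≤σ , σ³≈N = nonNegCubeRoot N (+-nonNeg (square-nonNeg a) (square-nonNeg b))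
        ρ , 0≤ρ , ρ²≈σ = squareRoot σ 0≤σ
    in root ρ 0≤ρ (begin
      ρ * ρ * ρ * (ρ * ρ * ρ)    ≈⟨ solve 1 (λ x →
        x :* x :* x :* (x :* x :* x) := x :* x :* (x :* x) :* (x :* x)) refl ρ ⟩
      ρ * ρ * (ρ * ρ) * (ρ * ρ)  ≈⟨ *-cong (*-cong ρ²≈σ ρ²≈σ) ρ²≈σ ⟩
      σ * σ * σ                  ≈⟨ σ³≈N ⟩
      N                          ∎)
    where
    N = a * a + b * b

    root : ∀ ρ → 0# ≤ ρ → ρ * ρ * ρ * (ρ * ρ * ρ) ≈ N → ∃[ w ] w ℂ.* w ℂ.* w ℂ.≈ (a , b)
    root ρ 0≤ρ ρ⁶≈N = sign (*-zero-product [c-b][c+b]≈0)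
      where
      ρ³ = ρ * ρ * ρ
      0≤ρ³ = *-nonNeg (square-nonNeg ρ) 0≤ρ

      0≤ρ⁶-a² : 0# ≤ ρ³ * ρ³ - a * a
      0≤ρ⁶-a² = ≤-gap (square-nonNeg b) (begin
        ρ³ * ρ³ - a * a        ≈⟨ +-congʳ ρ⁶≈N ⟩
        N - a * a              ≈⟨ solve 2 (λ x y → x :+ y :- x := con 0ℤ :+ y) refl (a * a) (b * b) ⟩
        0# + b * b             ∎)

      -ρ³≤a : - ρ³ ≤ a
      -ρ³≤a = ≤-gap (gap-nonNeg (square-≤ 0≤ρ³ (≤-gap 0≤ρ⁶-a²
          (solve 2 (λ r a → r :* r :- :- a :* :- a := con 0ℤ :+ (r :* r :- a :* a)) refl ρ³ a))))
        (solve 2 (λ r a → a := :- r :+ (r :- :- a)) refl ρ³ a)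

      tri = trisection a ρ 0≤ρ -ρ³≤a (square-≤ 0≤ρ³ 0≤ρ⁶-a²)
      x = proj₁ tri

      √ = squareRoot (ρ * ρ - x * x) (proj₁ (proj₂ tri))
      t = proj₁ √

      t²≈ρ²-x² : t * t ≈ ρ * ρ - x * x
      t²≈ρ²-x² = proj₂ (proj₂ √)

      -- The real and imaginary parts of (x + yi)³, in the shape to which `ℂ.*` unfolds.
      re im : Carrier → Carrier → Carrier
      re x y = (x * x - y * y) * x - (x * y + y * x) * y
      im x y = (x * x - y * y) * y + (x * y + y * x) * x

      re≈a : re x t ≈ a
      re≈a = begin
        (x * x - t * t) * x - (x * t + t * x) * t
          ≈⟨ solve 2 (λ x t → (x :* x :- t :* t) :* x :- (x :* t :+ t :* x) :* t :=
               x :* x :* x :- (t :* t :* x :+ t :* t :* x :+ t :* t :* x)) refl x t ⟩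
        x * x * x - 3* (t * t * x)
          ≈⟨ +-congˡ (-‿cong (+-cong (+-cong eq eq) eq)) ⟩
        x * x * x - 3* ((ρ * ρ - x * x) * x)
          ≈⟨ proj₂ (proj₂ tri) ⟩
        a ∎
        where
        eq : t * t * x ≈ (ρ * ρ - x * x) * x
        eq = *-congʳ t²≈ρ²-x²

      modulus : re x t * re x t + im x t * im x t ≈ N
      modulus = begin
        re x t * re x t + im x t * im x t
          ≈⟨ solve 2 (λ x y →
               let re = (x :* x :- y :* y) :* x :- (x :* y :+ y :* x) :* y
                   im = (x :* x :- y :* y) :* y :+ (x :* y :+ y :* x) :* x
                   n = x :* x :+ y :* y
               in re :* re :+ im :* im := n :* n :* n) refl x t ⟩
        (x * x + t * t) * (x * x + t * t) * (x * x + t * t)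
          ≈⟨ *-cong (*-cong x²+t²≈ρ² x²+t²≈ρ²) x²+t²≈ρ² ⟩
        ρ * ρ * (ρ * ρ) * (ρ * ρ)
          ≈⟨ solve 1 (λ x → x :* x :* (x :* x) :* (x :* x) := x :* x :* x :* (x :* x :* x)) refl ρ ⟩
        ρ³ * ρ³
          ≈⟨ ρ⁶≈N ⟩
        N ∎
        where
        x²+t²≈ρ² : x * x + t * t ≈ ρ * ρ
        x²+t²≈ρ² = trans (+-congˡ t²≈ρ²-x²)
          (solve 2 (λ x r → x :+ (r :- x) := r) refl (x * x) (ρ * ρ))

      [c-b][c+b]≈0 : (im x t - b) * (im x t + b) ≈ 0#
      [c-b][c+b]≈0 = begin
        (im x t - b) * (im x t + b)
          ≈⟨ solve 3 (λ c b a → (c :- b) :* (c :+ b) := a :* a :+ c :* c :- (a :* a :+ b :* b)) refl (im x t) b a ⟩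
        a * a + im x t * im x t - N
          ≈⟨ +-congʳ (+-congʳ (*-cong re≈a re≈a)) ⟨
        re x t * re x t + im x t * im x t - N
          ≈⟨ +-congʳ modulus ⟩
        N - N
          ≈⟨ -‿inverseʳ N ⟩
        0# ∎

      sign : im x t - b ≈ 0# ⊎ im x t + b ≈ 0# → ∃[ w ] w ℂ.* w ℂ.* w ℂ.≈ (a , b)
      sign (inj₁ c-b≈0) = (x , t) , re≈a , zero⇒≈ c-b≈0
      sign (inj₂ c+b≈0) = (x , - t) ,
        trans (solve 2 (λ x t → (x :* x :- :- t :* :- t) :* x :- (x :* :- t :+ :- t :* x) :* :- t :=
          (x :* x :- t :* t) :* x :- (x :* t :+ t :* x) :* t) refl x t) re≈a ,
        zero⇒≈ (begin
          im x (- t) - b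
            ≈⟨ solve 3 (λ x t b → (x :* x :- :- t :* :- t) :* :- t :+ (x :* :- t :+ :- t :* x) :* x :- b :=
                 :- ((x :* x :- t :* t) :* t :+ (x :* t :+ t :* x) :* x :+ b)) refl x t b ⟩
          - (im x t + b)  ≈⟨ -‿cong c+b≈0 ⟩
          - 0#            ≈⟨ solve 0 (:- con 0ℤ := con 0ℤ) refl ⟩
          0#              ∎)

-- Classical instantiation at the real and complex numbers

module _ {c ℓ₁ ℓ₂} (em : ExcludedMiddle (c ⊔ ℓ₁ ⊔ ℓ₂)) (ℝ : CompleteOrderedField c ℓ₁ ℓ₂) where

  private
    _≈?_ : Decidable (CompleteOrderedField._≈_ ℝ)
    x ≈? y = map′ lower lift (em {Lift (c ⊔ ℓ₂) (CompleteOrderedField._≈_ ℝ x y)})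

  scalars-field : ∀ 𝕂 → DecidableField (scalars ℝ 𝕂)
  scalars-field real    = RealRoots.decidableField ℝ _≈?_
  scalars-field complex = ComplexRoots.decidableFieldᶜ ℝ _≈?_

  scalars-cubeRoot : ∀ 𝕂 → let open CommutativeRing (scalars ℝ 𝕂) in
    ∀ x → ∃[ y ] y * y * y ≈ x
  scalars-cubeRoot real    = RealRoots.cubeRoot ℝ _≈?_
  scalars-cubeRoot complex = ComplexRoots.cubeRootᶜ ℝ _≈?_

open import Data.Nat.Base using (_≤_)

theorem20 :
  ∀ {c ℓ₁ ℓ₂} → ExcludedMiddle (c ⊔ ℓ₁ ⊔ ℓ₂) →
  (ℝ : CompleteOrderedField c ℓ₁ ℓ₂) (𝕂 : RealOrComplex) →
  let open Tensors (scalars ℝ 𝕂) in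
  ∀ {n} (T : Tensor n) → Symmetric T →
  (∃[ M ] Span (slices T) M × Invertible M) →
  ∀ r (n≤r : n ≤ r) →
  SRank≤ T r ⇔
  (∃ λ (S : Tensor r) →
    Symmetric S ×
    (∃[ Z ] Span (slices S) Z × Invertible Z) ×
    (∀ Z → Span (slices S) Z → (Z-inv : Invertible Z) →
      (∀ i j → Commute (inv Z Z-inv *ᴹ slices S i) (inv Z Z-inv *ᴹ slices S j)) ×
      (∀ i → Diagonalizable (inv Z Z-inv *ᴹ slices S i))) ×
    Subtensor n≤r T S)
-- Excluded middle acts twice: it decides equality of scalars, and it decides whether T is a sum of
-- a given number of cubes, which yields the minimum in the definition of rank.
theorem20 {c} {ℓ₁} {ℓ₂} em ℝ 𝕂 T _ = srank-characterization
  (scalars-cubeRoot em ℝ 𝕂) (λ _ _ → map′ lower lift (em {Lift ℓ₂ _})) T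
  where open SymmetricTensors (scalars ℝ 𝕂) (scalars-field em ℝ 𝕂)
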